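{- Under the standing assumptions below, let $c\in\mathcal{C}_{n-1}(n,q)$ with $\mathrm{wt}(c)\leq W(n,q)$ and suppose $|\mathbb{H}_c^\infty|=1$. Then $c$ is minimal.
   Context: Standing assumptions: $p$ is a prime, $q=p^h$ with $h\geq 2$, $q>27$, $n\geq 2$, and $q\geq\max\{32,2^{2n-4}\}$ if $h>2$, while $q\geq 2^{2n}$ if $h=2$. $\mathrm{PG}(n,q)$ is the Desarguesian projective space over $\mathbb{F}_q$; $\theta_m:=\frac{q^{m+1}-1}{q-1}$. $\mathcal{C}_{n-1}(n,q)$ is the $\mathbb{F}_p$-span of the characteristic functions (values in $\mathbb{F}_p$) of the hyperplanes of $\mathrm{PG}(n,q)$, as functions on points; hyperplanes are identified with their characteristic functions. $\mathrm{supp}(c)=\{P:c(P)\neq0\}$, $\mathrm{wt}(c)=|\mathrm{supp}(c)|$, $m_c:=\lceil\mathrm{wt}(c)/\theta_{n-1}\rceil$. $\Delta_{n,q}:=\lfloor 2^{ -(n-2)}\sqrt{q}\rfloor$ if $h>2$, $\Delta_{n,q}:=\lfloor p/2^n\rfloor$ if $h=2$; $W(n,q):=(\Delta_{n,q}-1)\theta_{n-1}$. For $c$ with $\mathrm{wt}(c)\leq W(n,q)$, $c$ is a linear combination with nonzero coefficients of a uniquely determined set $\mathcal{H}_c$ of exactly $m_c$ distinct hyperplanes, with uniquely determined coefficients; write $c(H)$ for the coefficient of $H\in\mathcal{H}_c$ and $c(H):=0$ for hyperplanes $H\notin\mathcal{H}_c$. For $\mathcal{H}\subseteq\mathcal{H}_c$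 put $c|_{\mathcal{H}}:=\sum_{H\in\mathcal{H}}c(H)H$. Points of $\mathrm{supp}(c)$ are real points of $c$; other points are holes of $c$. For a partition $\mathbb{H}$ of $\mathcal{H}_c$, let $\Gamma_{\mathbb{H}}$ be the graph with vertex set $\mathbb{H}$ in which distinct $\mathcal{H}_1,\mathcal{H}_2$ are adjacent iff there is a point $P$ such that: $P$ is a hole of $c$; $c|_{\mathcal{H}_1}(P)\neq0$ and $c|_{\mathcal{H}_2}(P)\neq0$; and $c|_{\mathcal{H}}(P)=0$ for all $\mathcal{H}\in\mathbb{H}\setminus\{\mathcal{H}_1,\mathcal{H}_2\}$. Let $\mathbb{H}_c^0$ be the partition of $\mathcal{H}_c$ into singletons, and for $i\geq0$ let $\mathbb{H}_c^{i+1}$ be the partition whose parts are the unions $\bigcup_{\mathcal{H}\in\mathbb{C}}\mathcal{H}$ over the vertex sets $\mathbb{C}$ of the connected components of $\Gamma_{\mathbb{H}_c^i}$. This sequence stabilizes; $\mathbb{H}_c^\infty$ denotes the eventual constant partition. A codeword $c$ is minimal if for every $c'\in\mathcal{C}_{n-1}(n,q)$ with $\mathrm{supp}(c')\subseteq\mathrm{supp}(c)$ there is $\alpha\in\mathbb{F}_p$ with $c'=\alpha c$. -}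

module Defs where

open import Level using (0ℓ)
open import Algebra.Core using (Op₁; Op₂)
open import Data.Bool using (Bool; true; false; T; if_then_else_)
open import Data.Empty using (⊥)
open import Data.Fin using (Fin; toℕ)
open import Data.List using (List; []; _∷_; map; length; filter; allFin; cartesianProductWith; mapMaybe)
open import Data.Nat.ListAction using (sum)
open import Data.Maybe using (Maybe; just; nothing)
open import Data.Nat using (ℕ; zero; suc; _∸_; _^_; _≤_; _<_; NonZero)
open import Data.Nat.DivMod using (_/_; _mod_)
open import Data.Product using (Σ; Σ-syntax; ∃; ∃-syntax; _×_; _,_)
open import Data.Vec using (Vec; []; _∷_; zipWith; foldr)
open import Function using (_∘_)
open import Function.Bundles using (_↔_; _⇔_; Inverse)
open import Relation.Binary.Definitions using (DecidableEquality)
open import Relation.Binary.PropositionalEquality using (_≡_; _≢_)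
open import Relation.Nullary using (¬_; does; yes; no)
open import Relation.Nullary.Decidable using (¬?)
open import Relation.Unary using (Pred)
import Algebra.Structures as AS
import Data.Nat as ℕ
import Data.Bool as 𝔹

-- A finite field with exactly q elements (F_q is unique up to isomorphism,
-- so PG(n,q) below is the Desarguesian projective space over it).

record FiniteField (q : ℕ) : Set₁ where
  infixl 6 _+_
  infixl 7 _*_
  field
    Carrier  : Set
    0# 1#    : Carrier
    _+_ _*_  : Op₂ Carrier
    -_       : Op₁ Carrier
    _⁻¹      : Op₁ Carrier
    isCommutativeRing : AS.IsCommutativeRing {A = Carrier} _≡_ _+_ _*_ -_ 0# 1#
    0≢1      : 0# ≢ 1#
    ⁻¹-inverse : ∀ x → x ≢ 0# → x * (x ⁻¹) ≡ 1#
    _≟_      : DecidableEquality Carrier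
    enumeration : Fin q ↔ Carrier

θ : ℕ → ℕ → ℕ
θ q zero    = 1
θ q (suc m) = θ q m ℕ.+ q ^ suc m

θ-suc : ∀ q m → Σ ℕ λ k → θ q m ≡ suc k
θ-suc q zero = 0 , _≡_.refl
θ-suc q (suc m) with θ q m | θ-suc q m
... | .(suc k) | k , _≡_.refl = k ℕ.+ q ^ suc m , _≡_.refl

θ-nonZero : ∀ q m → NonZero (θ q m)
θ-nonZero q m with θ q m | θ-suc q m
... | .(suc k) | k , _≡_.refl = _

⌈_/_⌉ : (a b : ℕ) .{{_ : NonZero b}} → ℕ
⌈ a / b ⌉ = (a ℕ.+ (b ∸ 1)) / b

-- Δ_{n,q} specified exactly as the floor:
--   h > 2 :  Δ = ⌊ 2^{-(n-2)} √q ⌋  ⇔  (Δ·2^{n-2})² ≤ q < ((Δ+1)·2^{n-2})²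
--   h = 2 :  Δ = ⌊ p / 2^n ⌋        ⇔  Δ·2^n ≤ p < (Δ+1)·2^n

IsΔ : (n p h q Δ : ℕ) → Set
IsΔ n p h q Δ =
  (2 < h → ((Δ ℕ.* 2 ^ (n ∸ 2)) ^ 2 ≤ q) × (q < (suc Δ ℕ.* 2 ^ (n ∸ 2)) ^ 2))
  × (h ≡ 2 → (Δ ℕ.* 2 ^ n ≤ p) × (p < suc Δ ℕ.* 2 ^ n))

W : (n q Δ : ℕ) → ℕ
W n q Δ = (Δ ∸ 1) ℕ.* θ q (n ∸ 1)

module PG {q : ℕ} (F : FiniteField q) (n : ℕ) where
  open FiniteField F

  elements : List Carrier
  elements = map (Inverse.to enumeration) (allFin q)

  allVecs : (m : ℕ) → List (Vec Carrier m)
  allVecs zero    = [] ∷ []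
  allVecs (suc m) = cartesianProductWith _∷_ elements (allVecs m)

  isNormalized : ∀ {m} → Vec Carrier m → Bool
  isNormalized []       = false
  isNormalized (x ∷ xs) = if does (x ≟ 0#) then isNormalized xs else does (x ≟ 1#)

  -- points of PG(n,q): 1-dim subspaces of F^{n+1}, via normalized representatives
  Point : Set
  Point = Σ (Vec Carrier (suc n)) (T ∘ isNormalized)

  -- hyperplanes of PG(n,q), via normalized dual coordinate vectors
  Hyperplane : Set
  Hyperplane = Σ (Vec Carrier (suc n)) (T ∘ isNormalized)

  toPoint : Vec Carrier (suc n) → Maybe Point
  toPoint v with isNormalized v in eq
  ... | true  = just (v , Relation.Binary.PropositionalEquality.subst T (Relation.Binary.PropositionalEquality.sym eq) _)
  ... | false = nothing

  allPoints : List Point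
  allPoints = mapMaybe toPoint (allVecs (suc n))

  dot : ∀ {m} → Vec Carrier m → Vec Carrier m → Carrier
  dot u v = foldr _ _+_ 0# (zipWith _*_ u v)

  χ : Hyperplane → Point → ℕ
  χ (a , _) (x , _) = if does (dot a x ≟ 0#) then 1 else 0

  module Code (p : ℕ) .{{_ : NonZero p}} where

    Word : Set
    Word = Point → Fin p

    sumFin : (k : ℕ) → (Fin k → ℕ) → ℕ
    sumFin k f = sum (map f (allFin k))

    lincomb : (k : ℕ) → (Fin k → Hyperplane) → (Fin k → Fin p) → Word
    lincomb k Hs αs P = sumFin k (λ i → toℕ (αs i) ℕ.* χ (Hs i) P) mod p

    InCode : Word → Set
    InCode c = Σ[ k ∈ ℕ ] Σ[ Hs ∈ (Fin k → Hyperplane) ] Σ[ αs ∈ (Fin k → Fin p) ]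
                 (∀ P → c P ≡ lincomb k Hs αs P)

    Real : Word → Point → Set
    Real c P = ¬ (toℕ (c P) ≡ 0)

    Hole : Word → Point → Set
    Hole c P = toℕ (c P) ≡ 0

    wt : Word → ℕ
    wt c = length (filter (λ P → ¬? (toℕ (c P) ℕ.≟ 0)) allPoints)

    m[_] : Word → ℕ
    m[ c ] = ⌈ wt c / θ q (n ∸ 1) ⌉ {{θ-nonZero q (n ∸ 1)}}

    Minimal : Word → Set
    Minimal c = ∀ (c' : Word) → InCode c' → (∀ P → Real c' P → Real c P) →
                ∃[ α ] (∀ P → c' P ≡ (toℕ {p} α ℕ.* toℕ (c P)) mod p)

    record Decomp (c : Word) : Set where
      field
        H        : Fin m[ c ] → Hyperplane
        coef     : Fin m[ c ] → Fin p
        distinct : ∀ i j → H i ≡ H j → i ≡ j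
        nonzero  : ∀ i → ¬ (toℕ (coef i) ≡ 0)
        sums     : ∀ P → c P ≡ lincomb m[ c ] H coef P

    module Partitions {c : Word} (D : Decomp c) where
      open Decomp D

      -- a partition of H_c = {H i}, given by its "same part" relation
      Rel : Set
      Rel = Fin m[ c ] → Fin m[ c ] → Bool

      -- c|_𝓗 (P) where 𝓗 is the part of the partition R containing H i
      restr : Rel → Fin m[ c ] → Point → ℕ
      restr R i P =
        toℕ (sumFin m[ c ] (λ j → if R j i then toℕ (coef j) ℕ.* χ (H j) P else 0) mod p)

      -- adjacency in Γ_R between the (distinct) parts of H i and H j
      Adjacent : Rel → Fin m[ c ] → Fin m[ c ] → Set
      Adjacent R i j =
        ¬ T (R i j) ×
        ∃[ P ] (Hole c P × ¬ (restr R i P ≡ 0) × ¬ (restr R j P ≡ 0) ×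
                (∀ k → ¬ T (R k i) → ¬ T (R k j) → restr R k P ≡ 0))

      data Connected (R : Rel) : Fin m[ c ] → Fin m[ c ] → Set where
        here    : ∀ {i} → Connected R i i
        inPart  : ∀ {i j k} → T (R i j) → Connected R j k → Connected R i k
        viaEdge : ∀ {i j k} → Adjacent R i j → Connected R j k → Connected R i k

      IsStep : Rel → Rel → Set
      IsStep R R' = ∀ i j → (T (R' i j) ⇔ Connected R i j)

      Stage : ℕ → Rel → Set
      Stage zero    R  = ∀ i j → (T (R i j) ⇔ (i ≡ j))
      Stage (suc k) R' = Σ[ R ∈ Rel ] (Stage k R × IsStep R R')

      SinglePart : Rel → Set
      SinglePart R = Fin m[ c ] × (∀ i j → T (R i j))

      -- |H_c^∞| = 1 : some stage is stable (H^{k+1} = H^k, so H^∞ = H^k)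
      -- and consists of exactly one part
      InftyIsSingle : Set
      InftyIsSingle = ∃[ k ] ∃[ R ] (Stage k R × IsStep R R × SinglePart R)

{-# OPTIONS --safe #-}

-- Let c be a combination of the hyperplanes H₁, …, H_m; the weight bound gives p m < q.
-- The crux is that every codeword w with supp(w) ⊆ H₁ ∪ … ∪ H_m is an F_p-combination of
-- the Hᵢ.  For P, Q ∈ H₁ off the other k = m − 1 hyperplanes and R ∉ H₁, put
-- v(x, y) = (1 − y)P + xR + yQ.  The indicator function of a hyperplane is, up to a constant,
-- a product of q − 1 affine functions of (x, y), and such a product with fewer than 2(q − 1)
-- factors sums to zero over F_q².  Testing w against the product of the forms of H₂, …, H_m and
-- of suitable factors y − z shows that w ∏ᵢ≥₂ Hᵢ, restricted to the line x = 0, is either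
-- identically zero or has at most k zeros.  The same holds for w − bH₁ with b ∈ F_p; as
-- p k < q, one of these p functions vanishes identically, so w(P) = w(Q).  Hence w is constant
-- on H₁ off the other hyperplanes, and subtracting that multiple of H₁ gives an induction on m.
--
-- So a codeword c′ with supp(c′) ⊆ supp(c) is Σ βᵢHᵢ.  At a hole of c that joins two parts of a
-- partition, both c and c′ vanish, which forces the ratios βᵢ / c(Hᵢ) on the two parts to agree.
-- Inductively the ratio is constant on the parts of every ℍ_c^i, hence globally.

module Submission where

open import Defs
open import Algebra.Bundles using (CommutativeRing)
open import Data.Bool using (Bool; true; false; T; T?; if_then_else_)
open import Data.Empty using (⊥-elim)
open import Data.Fin using (Fin; zero; suc; toℕ; punchIn; inject≤)
open import Data.Fin.Properties using (suc-injective; any?; all?; punchIn-injective; punchInᵢ≢i; inject≤-injective; toℕ-fromℕ<; toℕ-injective; toℕ<n)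
open import Data.Fin.Permutation using (permutation)
open import Data.List using (List; []; _∷_; _++_; map; length; filter; allFin; tabulate)
open import Data.List.Membership.Propositional using (_∈_; lose)
open import Data.List.Membership.Propositional.Properties using (∈-filter⁺; ∈-filter⁻; ∈-tabulate⁺; ∈-allFin)
open import Data.List.Properties using (filter-notAll; length-tabulate; length-map; length-++; map-tabulate)
open import Data.List.Relation.Unary.Any using (here; there)
open import Data.Nat using (ℕ; zero; suc; _≤_; _<_; _∸_; NonZero; z≤n; s≤s)
open import Data.Nat.ListAction using () renaming (sum to ℕsum)
open import Data.Nat.Coprimality using (coprime-Bézout; prime⇒coprime)
open import Data.Nat.GCD using (module Bézout)
open import Data.Nat.DivMod using (_/_; _%_; _mod_; m%n<n; m≡m%n+[m/n]*n; m<n*o⇒m/o<n)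
open import Data.Nat.Primality using (Prime)
open import Data.Product using (Σ; ∃; _×_; _,_; proj₁; proj₂)
open import Data.Sum using (_⊎_; inj₁; inj₂)
open import Data.Vec using (Vec; []; _∷_; replicate)
open import Function using (_∘_; id)
open import Function.Bundles using (Inverse; Equivalence)
open import Function.Definitions using (Injective)
open import Relation.Binary.PropositionalEquality using (_≡_; _≢_; refl; sym; trans; cong; cong₂; subst; module ≡-Reasoning)
open import Relation.Nullary using (¬_; Dec; yes; no; does; contradiction)
open import Relation.Nullary.Decidable using (¬?; map′; _×-dec_; decidable-stable)
import Data.Nat as ℕ
import Data.Vec as Vec
import Data.Vec.Functional as VF
import Data.Nat.Properties as ℕₚ

-- Arithmetic and sums over a finite field.

module Field {q : ℕ} (F : FiniteField q) where
  open FiniteField F renaming (_+_ to infixl 6 _+_; _*_ to infixl 7 _*_; -_ to infix 8 -_; _≟_ to infix 4 _≟_; _⁻¹ to infix 9 _⁻¹)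
  open ≡-Reasoning

  commutativeRing : CommutativeRing _ _
  commutativeRing = record { isCommutativeRing = isCommutativeRing }

  open CommutativeRing commutativeRing public
    using (+-assoc; *-comm; *-assoc; +-identityˡ; +-identityʳ; *-identityˡ; *-identityʳ;
           zeroˡ; zeroʳ; distribʳ; -‿inverseˡ; -‿inverseʳ; semiring; commutativeSemiring)
  open import Algebra.Properties.Group (CommutativeRing.+-group commutativeRing) public
    using (x∙y⁻¹≈ε⇒x≈y)
  open import Algebra.Properties.Ring (CommutativeRing.ring commutativeRing) public
    using (-‿distribˡ-*; -‿distribʳ-*; +-cancelˡ)
  open import Algebra.Properties.Semiring.Sum semiring public
    using (sum; sum-cong-≗; sum-replicate; sum-replicate-zero; sum-remove; sum-permute;
           ∑-distrib-+; *-distribˡ-sum)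
  open import Algebra.Properties.Semiring.Mult semiring public
    using (×1-homo-*; ×-homo-+) renaming (_×_ to infixr 9 _·_)
  open import Algebra.Properties.Semiring.Exp semiring public
    using () renaming (_^_ to infixr 9 _^F_)
  open import Algebra.Properties.CommutativeSemiring.Exp commutativeSemiring public
    using (^-distrib-*)

  open import Algebra.Solver.Ring.NaturalCoefficients.Default commutativeSemiring public
    using (solve; _:=_; _:+_; _:*_; con)

  integral : ∀ {x y} → x * y ≡ 0# → x ≢ 0# → y ≡ 0#
  integral {x} {y} xy≡0 x≢0 = begin
    y              ≡⟨ *-identityˡ y ⟨
    1# * y         ≡⟨ cong (_* y) (⁻¹-inverse x x≢0) ⟨
    x * x ⁻¹ * y   ≡⟨ solve 3 (λ a b c → a :* b :* c := b :* (a :* c)) refl x (x ⁻¹) y ⟩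
    x ⁻¹ * (x * y) ≡⟨ cong (x ⁻¹ *_) xy≡0 ⟩
    x ⁻¹ * 0#      ≡⟨ zeroʳ _ ⟩
    0#             ∎

  *-nonzero : ∀ {x y} → x ≢ 0# → y ≢ 0# → x * y ≢ 0#
  *-nonzero x≢0 y≢0 xy≡0 = y≢0 (integral xy≡0 x≢0)

  x+-y≡0⇒x≡y : ∀ {x y} → x + - y ≡ 0# → x ≡ y
  x+-y≡0⇒x≡y {x} {y} = x∙y⁻¹≈ε⇒x≈y x y

  +-cancelˡ-0 : ∀ {x y} → x ≡ x + y → y ≡ 0#
  +-cancelˡ-0 {x} {y} eq = begin
    y             ≡⟨ +-identityˡ y ⟨
    0# + y        ≡⟨ cong (_+ y) (-‿inverseˡ x) ⟨
    - x + x + y   ≡⟨ +-assoc _ _ _ ⟩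
    - x + (x + y) ≡⟨ cong (- x +_) eq ⟨
    - x + x       ≡⟨ -‿inverseˡ x ⟩
    0#            ∎

  elem : Fin q → Carrier
  elem = Inverse.to enumeration

  index : Carrier → Fin q
  index = Inverse.from enumeration

  elem-index : ∀ x → elem (index x) ≡ x
  elem-index x = Inverse.inverseˡ enumeration refl

  index-elem : ∀ i → index (elem i) ≡ i
  index-elem i = Inverse.inverseʳ enumeration refl

  elem-injective : Injective _≡_ _≡_ elem
  elem-injective {i} {j} eq = trans (sym (index-elem i)) (trans (cong index eq) (index-elem j))

  -- Searching the enumeration decides existence; the later case splits on the existence of scalars
  -- and vectors rest on this search and on `∃Vec?`.
  ∃? : ∀ {P : Carrier → Set} → (∀ x → Dec (P x)) → Dec (∃ P)
  ∃? {P} P? = map′ (λ (i , pi) → elem i , pi)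
                   (λ (x , px) → index x , subst P (sym (elem-index x)) px)
                   (any? (P? ∘ elem))

  ∃Vec? : ∀ m {P : Vec Carrier m → Set} → (∀ v → Dec (P v)) → Dec (∃ P)
  ∃Vec? zero    P? = map′ ([] ,_) (λ { ([] , p) → p }) (P? [])
  ∃Vec? (suc m) P? = map′ (λ (x , v , p) → x ∷ v , p) (λ { (x ∷ v , p) → x , v , p })
                          (∃? λ x → ∃Vec? m λ v → P? (x ∷ v))

  sum-zero : ∀ {n} {f : Fin n → Carrier} → (∀ i → f i ≡ 0#) → sum f ≡ 0#
  sum-zero {n} f≡0 = trans (sum-cong-≗ f≡0) (sum-replicate-zero n)

  sum-single : ∀ {n} (f : Fin n → Carrier) i → (∀ j → j ≢ i → f j ≡ 0#) → sum f ≡ f i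
  sum-single {suc n} f i f≡0 = begin
    sum f                              ≡⟨ sum-remove {i = i} f ⟩
    f i + sum (λ j → f (punchIn i j))  ≡⟨ cong (f i +_) (sum-zero λ j → f≡0 _ (punchInᵢ≢i i j)) ⟩
    f i + 0#                           ≡⟨ +-identityʳ _ ⟩
    f i                                ∎

  ∑F : (Carrier → Carrier) → Carrier
  ∑F f = sum (f ∘ elem)

  ∑F-cong : ∀ {f g} → (∀ x → f x ≡ g x) → ∑F f ≡ ∑F g
  ∑F-cong eq = sum-cong-≗ (eq ∘ elem)

  ∑F-zero : ∀ {f} → (∀ x → f x ≡ 0#) → ∑F f ≡ 0#
  ∑F-zero eq = sum-zero (eq ∘ elem)

  ∑F-+ : ∀ f g → ∑F (λ x → f x + g x) ≡ ∑F f + ∑F g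
  ∑F-+ f g = ∑-distrib-+ (f ∘ elem) (g ∘ elem)

  ∑F-* : ∀ a f → ∑F (λ x → a * f x) ≡ a * ∑F f
  ∑F-* a f = sym (*-distribˡ-sum a (f ∘ elem))

  ∑F-single : ∀ f y → (∀ x → x ≢ y → f x ≡ 0#) → ∑F f ≡ f y
  ∑F-single f y f≡0 = trans
    (sum-single (f ∘ elem) (index y) λ j j≢ → f≡0 _ λ eq →
      j≢ (trans (sym (index-elem j)) (cong index eq)))
    (cong f (elem-index y))

  ∑F-reindex : ∀ f (g g⁻¹ : Carrier → Carrier) → (∀ x → g (g⁻¹ x) ≡ x) → (∀ x → g⁻¹ (g x) ≡ x) →
               ∑F f ≡ ∑F (f ∘ g)
  ∑F-reindex f g g⁻¹ gg⁻¹ g⁻¹g = trans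
    (sum-permute (f ∘ elem) (permutation (index ∘ g ∘ elem) (index ∘ g⁻¹ ∘ elem)
      (inverse g g⁻¹ gg⁻¹) (inverse g⁻¹ g g⁻¹g)))
    (sum-cong-≗ {q} λ i → cong f (elem-index (g (elem i))))
    where
    inverse : ∀ (g h : Carrier → Carrier) → (∀ x → g (h x) ≡ x) →
              ∀ i → index (g (elem (index (h (elem i))))) ≡ i
    inverse g h gh i = trans (cong (index ∘ g) (elem-index _)) (trans (cong index (gh _)) (index-elem i))

  ι : ℕ → Carrier
  ι n = n · 1#

  ι-+ : ∀ m n → ι (m ℕ.+ n) ≡ ι m + ι n
  ι-+ = ×-homo-+ 1#

  ι-* : ∀ m n → ι (m ℕ.* n) ≡ ι m * ι n
  ι-* = ×1-homo-*

  -- The translation x ↦ x + 1 permutes F, so the sum of all elements equals itself plus q times 1.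
  ιq≡0 : ι q ≡ 0#
  ιq≡0 = +-cancelˡ-0 {∑F id} (begin
    ∑F id              ≡⟨ ∑F-reindex id (_+ 1#) (_+ - 1#) (λ x → cancel x (-‿inverseˡ 1#)) (λ x → cancel x (-‿inverseʳ 1#)) ⟩
    ∑F (_+ 1#)         ≡⟨ ∑F-+ id (λ _ → 1#) ⟩
    ∑F id + ∑F (λ _ → 1#) ≡⟨ cong (∑F id +_) (sum-replicate q) ⟩
    ∑F id + ι q        ∎)
    where
    cancel : ∀ x {a b} → a + b ≡ 0# → x + a + b ≡ x
    cancel x eq = trans (+-assoc _ _ _) (trans (cong (x +_) eq) (+-identityʳ x))

  -- Roots of polynomials and power sums.

  -- Polynomials as coefficient vectors, constant term first.

  eval : ∀ {n} → Vec Carrier n → Carrier → Carrier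
  eval []       x = 0#
  eval (c ∷ cs) x = c + x * eval cs x

  -- Synthetic division by X - a: each coefficient of the quotient is the Horner value at a of a
  -- tail of the dividend.
  quotient : ∀ {n} → Carrier → Vec Carrier (suc n) → Vec Carrier n
  quotient a (c ∷ [])     = []
  quotient a (c ∷ d ∷ cs) = eval (d ∷ cs) a ∷ quotient a (d ∷ cs)

  eval-quotient : ∀ {n} a (cs : Vec Carrier (suc n)) x →
                  eval cs x ≡ eval cs a + (x + - a) * eval (quotient a cs) x
  eval-quotient a (c ∷ []) x = solve 4 (λ a c x b → c :+ x :* con 0 := c :+ a :* con 0 :+ (x :+ b) :* con 0) refl a c x (- a)
  eval-quotient a (c ∷ d ∷ cs) x = begin
    c + x * eval (d ∷ cs) x                        ≡⟨ cong (λ t → c + x * t) (eval-quotient a (d ∷ cs) x) ⟩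
    c + x * (e + (x + - a) * r)                    ≡⟨ lemma c x e a r (- a) (-‿inverseʳ a) ⟩
    c + a * e + (x + - a) * (e + x * r)            ∎
    where
    e = eval (d ∷ cs) a
    r = eval (quotient a (d ∷ cs)) x
    -- The solver knows only semirings, so b stands for - a, and the summand (a + b) * e, zero in
    -- the application, is added to make the identity hold without subtraction.
    lemma′ : ∀ c x e a r b → c + x * (e + (x + b) * r) + (a + b) * e ≡ c + a * e + (x + b) * (e + x * r)
    lemma′ = solve 6 (λ c x e a r b → c :+ x :* (e :+ (x :+ b) :* r) :+ (a :+ b) :* e :=
                                      c :+ a :* e :+ (x :+ b) :* (e :+ x :* r)) refl
    lemma : ∀ c x e a r b → a + b ≡ 0# → c + x * (e + (x + b) * r) ≡ c + a * e + (x + b) * (e + x * r)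
    lemma c x e a r b eq = trans (sym (trans (cong (λ t → c + x * (e + (x + b) * r) + t * e) eq)
                                   (trans (cong (_ +_) (zeroˡ e)) (+-identityʳ _))))
                                 (lemma′ c x e a r b)

  -- A vector of length n has degree below n. Dividing off X - a for one root a keeps the other
  -- roots, because x - a is nonzero there.
  too-many-roots : ∀ {n} (cs : Vec Carrier n) (root : Fin n → Carrier) → Injective _≡_ _≡_ root →
                   (∀ i → eval cs (root i) ≡ 0#) → ∀ x → eval cs x ≡ 0#
  too-many-roots []         root inj isRoot x = refl
  too-many-roots cs@(_ ∷ _) root inj isRoot x = begin
    eval cs x                                       ≡⟨ split x ⟩
    (x + - a) * eval (quotient a cs) x              ≡⟨ cong ((x + - a) *_) (too-many-roots (quotient a cs) (root ∘ suc)
                                                        (λ eq → suc-injective (inj eq)) isRoot′ x) ⟩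
    (x + - a) * 0#                                  ≡⟨ zeroʳ _ ⟩
    0#                                              ∎
    where
    a = root zero
    split : ∀ x → eval cs x ≡ (x + - a) * eval (quotient a cs) x
    split x = trans (eval-quotient a cs x) (trans (cong (_+ (x + - a) * eval (quotient a cs) x) (isRoot zero)) (+-identityˡ _))
    isRoot′ : ∀ i → eval (quotient a cs) (root (suc i)) ≡ 0#
    isRoot′ i = integral (trans (sym (split _)) (isRoot (suc i)))
      λ eq → contradiction (inj (x+-y≡0⇒x≡y eq)) λ ()

  xpow : ∀ i → Vec Carrier (suc i)
  xpow zero    = 1# ∷ []
  xpow (suc i) = 0# ∷ xpow i

  eval-xpow : ∀ i x → eval (xpow i) x ≡ x ^F i
  eval-xpow zero    x = trans (cong (1# +_) (zeroʳ x)) (+-identityʳ 1#)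
  eval-xpow (suc i) x = trans (+-identityˡ _) (cong (x *_) (eval-xpow i x))

  -- Supplies roots for the next argument: `punchIn` skips the index of 0, and only m of the other
  -- elements are kept, to match the length of a coefficient vector.
  nonzeros : ∀ {m N} → suc m ≤ N → (e : Fin N → Carrier) → Injective _≡_ _≡_ e → (z : Fin N) → e z ≡ 0# →
             Σ (Fin m → Carrier) λ r → Injective _≡_ _≡_ r × (∀ i → r i ≢ 0#)
  nonzeros {m} {suc N} (s≤s m≤N) e inj z ez≡0 =
    (λ i → e (punchIn z (inject≤ i m≤N))) ,
    (λ eq → inject≤-injective m≤N m≤N _ _ (punchIn-injective z _ _ (inj eq))) ,
    (λ i eq → punchInᵢ≢i z _ (inj (trans eq (sym ez≡0))))

  -- X^{i+1} − 1 has fewer than q − 1 roots.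
  not-all-powers-trivial : ∀ i → 3 ℕ.+ i ≤ q → ∃ λ a → a ≢ 0# × a ^F suc i ≢ 1#
  not-all-powers-trivial i i<q with ∃? (λ a → ¬? (a ≟ 0#) ×-dec ¬? (a ^F suc i ≟ 1#))
  ... | yes found = found
  ... | no  none  = contradiction impossible (λ eq → 0≢1 (sym eq))
    where
    roots = nonzeros i<q elem elem-injective (index 0#) (elem-index 0#)
    -- If all these powers were 1, this vector of length i + 2 would have i + 2 distinct nonzero
    -- roots and hence vanish at 0, where its value is - 1.
    cs = - 1# ∷ xpow i
    isRoot : ∀ j → eval cs (proj₁ roots j) ≡ 0#
    isRoot j = let r = proj₁ roots j in begin
      - 1# + r * eval (xpow i) r ≡⟨ cong (λ t → - 1# + r * t) (eval-xpow i r) ⟩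
      - 1# + r ^F suc i          ≡⟨ cong (- 1# +_) (decidable-stable (_ ≟ _) λ ≢1 → none (r , proj₂ (proj₂ roots) j , ≢1)) ⟩
      - 1# + 1#                  ≡⟨ -‿inverseˡ 1# ⟩
      0#                         ∎
    impossible : 1# ≡ 0#
    impossible = begin
      1#                               ≡⟨ +-identityʳ 1# ⟨
      1# + 0#                          ≡⟨ cong (1# +_) (too-many-roots cs (proj₁ roots) (proj₁ (proj₂ roots)) isRoot 0#) ⟨
      1# + (- 1# + 0# * eval (xpow i) 0#) ≡⟨ cong (λ t → 1# + (- 1# + t)) (zeroˡ _) ⟩
      1# + (- 1# + 0#)                 ≡⟨ cong (1# +_) (+-identityʳ _) ⟩
      1# + - 1#                        ≡⟨ -‿inverseʳ 1# ⟩
      0#                               ∎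

  -- Substituting a * x for x multiplies the sum by the i-th power of a, and for positive i ≤ q - 2
  -- some nonzero a makes this factor differ from 1. Exponent 0 gives q times 1.
  power-sum : ∀ i → 2 ℕ.+ i ≤ q → ∑F (_^F i) ≡ 0#
  power-sum zero    _   = trans (sum-replicate q) ιq≡0
  power-sum (suc i) i<q = integral (begin
    (1# + - t) * S       ≡⟨ distribʳ S 1# (- t) ⟩
    1# * S + - t * S     ≡⟨ cong (λ u → 1# * u + - t * S) S≡tS ⟩
    1# * (t * S) + - t * S ≡⟨ cong (_+ - t * S) (*-identityˡ _) ⟩
    t * S + - t * S      ≡⟨ distribʳ S t (- t) ⟨
    (t + - t) * S        ≡⟨ cong (_* S) (-‿inverseʳ t) ⟩
    0# * S               ≡⟨ zeroˡ S ⟩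
    0#                   ∎) λ eq → t≢1 (sym (x+-y≡0⇒x≡y eq))
    where
    a = proj₁ (not-all-powers-trivial i i<q)
    a≢0 = proj₁ (proj₂ (not-all-powers-trivial i i<q))
    t = a ^F suc i
    t≢1 = proj₂ (proj₂ (not-all-powers-trivial i i<q))
    S = ∑F (_^F suc i)
    cancel : ∀ {b c} → b * c ≡ 1# → ∀ x → b * (c * x) ≡ x
    cancel eq x = trans (sym (*-assoc _ _ _)) (trans (cong (_* x) eq) (*-identityˡ x))
    S≡tS : S ≡ t * S
    S≡tS = begin
      S                              ≡⟨ ∑F-reindex (_^F suc i) (a *_) (a ⁻¹ *_) (cancel (⁻¹-inverse a a≢0))
                                          (cancel (trans (*-comm _ _) (⁻¹-inverse a a≢0))) ⟩
      ∑F (λ x → (a * x) ^F suc i)    ≡⟨ ∑F-cong (λ x → ^-distrib-* a x (suc i)) ⟩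
      ∑F (λ x → t * x ^F suc i)      ≡⟨ ∑F-* t (_^F suc i) ⟩
      t * S                          ∎

  -- Sums over F × F of products of affine functions.

  ∑∑ : (Carrier → Carrier → Carrier) → Carrier
  ∑∑ f = ∑F λ x → ∑F (f x)

  ∑∑-cong : ∀ {f g} → (∀ x y → f x y ≡ g x y) → ∑∑ f ≡ ∑∑ g
  ∑∑-cong eq = ∑F-cong λ x → ∑F-cong (eq x)

  ∑∑-+ : ∀ f g → ∑∑ (λ x y → f x y + g x y) ≡ ∑∑ f + ∑∑ g
  ∑∑-+ f g = trans (∑F-cong λ x → ∑F-+ (f x) (g x)) (∑F-+ (λ x → ∑F (f x)) (λ x → ∑F (g x)))

  ∑∑-* : ∀ a f → ∑∑ (λ x y → a * f x y) ≡ a * ∑∑ f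
  ∑∑-* a f = trans (∑F-cong λ x → ∑F-* a (f x)) (∑F-* a (λ x → ∑F (f x)))

  Affine : Set
  Affine = Carrier × Carrier × Carrier

  at : Affine → Carrier → Carrier → Carrier
  at (a , b , c) x y = a + b * x + c * y

  ∏ : List Affine → Carrier → Carrier → Carrier
  ∏ []       x y = 1#
  ∏ (l ∷ ls) x y = at l x y * ∏ ls x y

  ∏-++ : ∀ ls ms x y → ∏ (ls ++ ms) x y ≡ ∏ ls x y * ∏ ms x y
  ∏-++ []       ms x y = sym (*-identityˡ _)
  ∏-++ (l ∷ ls) ms x y = trans (cong (at l x y *_) (∏-++ ls ms x y)) (sym (*-assoc _ _ _))

  ∏-tabulate-zero : ∀ {k} (l : Fin k → Affine) i {x y} → at (l i) x y ≡ 0# → ∏ (tabulate l) x y ≡ 0#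
  ∏-tabulate-zero l zero    {x} {y} eq = trans (cong (_* ∏ (tabulate (l ∘ suc)) x y) eq) (zeroˡ _)
  ∏-tabulate-zero l (suc i) {x} {y} eq = trans (cong (at (l zero) x y *_) (∏-tabulate-zero (l ∘ suc) i eq)) (zeroʳ _)

  ∏-tabulate-nonzero : ∀ {k} (l : Fin k → Affine) {x y} → (∀ i → at (l i) x y ≢ 0#) → ∏ (tabulate l) x y ≢ 0#
  ∏-tabulate-nonzero {zero}  l ≢0 eq = 0≢1 (sym eq)
  ∏-tabulate-nonzero {suc k} l ≢0 = *-nonzero (≢0 zero) (∏-tabulate-nonzero (l ∘ suc) (≢0 ∘ suc))

  -- Expanding one affine factor raises the degree i + j by at most one and uses up that factor, so
  -- the bound persists. With no factor left, i + j ≤ 2q - 3, hence i or j is at most q - 2 and its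
  -- power sum vanishes.
  ∑∑-monomial-∏ : ∀ ls i j → length ls ℕ.+ (i ℕ.+ j) ℕ.+ 3 ≤ q ℕ.+ q →
                  ∑∑ (λ x y → x ^F i * y ^F j * ∏ ls x y) ≡ 0#
  ∑∑-monomial-∏ [] i j bound = begin
    ∑∑ (λ x y → x ^F i * y ^F j * 1#)      ≡⟨ ∑∑-cong (λ x y → *-identityʳ (x ^F i * y ^F j)) ⟩
    ∑∑ (λ x y → x ^F i * y ^F j)           ≡⟨ ∑F-cong (λ x → ∑F-* (x ^F i) (_^F j)) ⟩
    ∑F (λ x → x ^F i * ∑F (_^F j))         ≡⟨ ∑F-cong (λ x → *-comm (x ^F i) (∑F (_^F j))) ⟩
    ∑F (λ x → ∑F (_^F j) * x ^F i)         ≡⟨ ∑F-* (∑F (_^F j)) (_^F i) ⟩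
    ∑F (_^F j) * ∑F (_^F i)                ≡⟨ one-vanishes (2 ℕ.+ j ℕ.≤? q) ⟩
    0#                                     ∎
    where
    one-vanishes : Dec (2 ℕ.+ j ≤ q) → ∑F (_^F j) * ∑F (_^F i) ≡ 0#
    one-vanishes (yes j<q) = trans (cong (_* ∑F (_^F i)) (power-sum j j<q)) (zeroˡ _)
    one-vanishes (no  j≮q) = trans (cong (∑F (_^F j) *_) (power-sum i i<q)) (zeroʳ _)
      where
      i<q : 2 ℕ.+ i ≤ q
      i<q = ℕₚ.+-cancelʳ-≤ q (2 ℕ.+ i) q (ℕₚ.≤-trans
        (ℕₚ.+-monoʳ-≤ (2 ℕ.+ i) (ℕₚ.≤-pred (ℕₚ.≰⇒> j≮q)))
        (subst (_≤ q ℕ.+ q) (trans (ℕₚ.+-comm (i ℕ.+ j) 3) (cong (2 ℕ.+_) (sym (ℕₚ.+-suc i j)))) bound))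
  ∑∑-monomial-∏ ((a , b , c) ∷ ls) i j bound = begin
    ∑∑ (λ x y → x ^F i * y ^F j * ((a + b * x + c * y) * ∏ ls x y))
      ≡⟨ ∑∑-cong (λ x y → solve 8 (λ a b c x y X Y r →
           X :* Y :* ((a :+ b :* x :+ c :* y) :* r) :=
           a :* (X :* Y :* r) :+ (b :* (x :* X :* Y :* r) :+ c :* (X :* (y :* Y) :* r))) refl
           a b c x y (x ^F i) (y ^F j) (∏ ls x y)) ⟩
    ∑∑ (λ x y → term a i j x y + (term b (suc i) j x y + term c i (suc j) x y))
      ≡⟨ ∑∑-+ (term a i j) (λ x y → term b (suc i) j x y + term c i (suc j) x y) ⟩
    ∑∑ (term a i j) + ∑∑ (λ x y → term b (suc i) j x y + term c i (suc j) x y)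
      ≡⟨ cong₂ _+_ (vanish a i j (ℕₚ.≤-trans (ℕₚ.n≤1+n _) bound)) (∑∑-+ (term b (suc i) j) (term c i (suc j))) ⟩
    0# + (∑∑ (term b (suc i) j) + ∑∑ (term c i (suc j)))
      ≡⟨ cong (0# +_) (cong₂ _+_
           (vanish b (suc i) j (subst (λ t → t ℕ.+ 3 ≤ q ℕ.+ q) (sym (ℕₚ.+-suc (length ls) (i ℕ.+ j))) bound))
           (vanish c i (suc j) (subst (λ t → t ℕ.+ 3 ≤ q ℕ.+ q)
             (sym (trans (cong (length ls ℕ.+_) (ℕₚ.+-suc i j)) (ℕₚ.+-suc (length ls) (i ℕ.+ j)))) bound))) ⟩
    0# + (0# + 0#)
      ≡⟨ trans (+-identityˡ _) (+-identityˡ _) ⟩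
    0# ∎
    where
    term : Carrier → ℕ → ℕ → Carrier → Carrier → Carrier
    term d i j x y = d * (x ^F i * y ^F j * ∏ ls x y)
    vanish : ∀ d i j → length ls ℕ.+ (i ℕ.+ j) ℕ.+ 3 ≤ q ℕ.+ q → ∑∑ (term d i j) ≡ 0#
    vanish d i j bound = trans (∑∑-* d (λ x y → x ^F i * y ^F j * ∏ ls x y))
      (trans (cong (d *_) (∑∑-monomial-∏ ls i j bound)) (zeroʳ d))

  ∑∑-∏ : ∀ ls → length ls ℕ.+ 3 ≤ q ℕ.+ q → ∑∑ (∏ ls) ≡ 0#
  ∑∑-∏ ls bound = trans
    (∑∑-cong λ x y → sym (trans (cong (_* ∏ ls x y) (*-identityˡ 1#)) (*-identityˡ _)))
    (∑∑-monomial-∏ ls 0 0 (subst (λ t → t ℕ.+ 3 ≤ q ℕ.+ q) (sym (ℕₚ.+-identityʳ (length ls))) bound))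

  -- Polynomials with prescribed roots and the indicator of zero.

  withRoots : List Carrier → Carrier → Carrier
  withRoots []       t = 1#
  withRoots (z ∷ zs) t = (t + - z) * withRoots zs t

  withRoots-∈ : ∀ {zs t} → t ∈ zs → withRoots zs t ≡ 0#
  withRoots-∈ {_ ∷ zs} {t} (here refl) = trans (cong (_* withRoots zs t) (-‿inverseʳ t)) (zeroˡ _)
  withRoots-∈ {z ∷ _} {t} (there t∈zs) = trans (cong ((t + - z) *_) (withRoots-∈ t∈zs)) (zeroʳ _)

  withRoots-∉ : ∀ zs {t} → ¬ t ∈ zs → withRoots zs t ≢ 0#
  withRoots-∉ []       t∉zs eq = 0≢1 (sym eq)
  withRoots-∉ (z ∷ zs) t∉zs =
    *-nonzero (λ eq → t∉zs (here (x+-y≡0⇒x≡y eq))) (withRoots-∉ zs (t∉zs ∘ there))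

  shift : Affine → Carrier → Affine
  shift (a , b , c) z = a + - z , b , c

  -- Brings a split polynomial in an affine function into the form of a product of affine functions,
  -- to which `∑∑-∏` applies.
  ∏-shift : ∀ l zs x y → ∏ (map (shift l) zs) x y ≡ withRoots zs (at l x y)
  ∏-shift l []       x y = refl
  ∏-shift l@(a , b , c) (z ∷ zs) x y = cong₂ _*_
    (solve 4 (λ a z s t → a :+ z :+ s :+ t := a :+ s :+ t :+ z) refl a (- z) (b * x) (c * y))
    (∏-shift l zs x y)

  elements : List Carrier
  elements = tabulate elem

  ∈-elements : ∀ x → x ∈ elements
  ∈-elements x = subst (_∈ elements) (elem-index x) (∈-tabulate⁺ (index x))

  units : List Carrier
  units = filter (λ x → ¬? (x ≟ 0#)) elements

  length-units : length units < q
  length-units = subst (length units <_) (length-tabulate elem)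
    (filter-notAll (λ x → ¬? (x ≟ 0#)) elements (lose (∈-elements 0#) λ 0≢0 → 0≢0 refl))

  -- Up to the nonzero constant δ(0), the indicator function of 0 in F, written with at most q - 1
  -- linear factors.
  δ : Carrier → Carrier
  δ = withRoots units

  δ-nonzero : ∀ {t} → t ≢ 0# → δ t ≡ 0#
  δ-nonzero t≢0 = withRoots-∈ (∈-filter⁺ (λ x → ¬? (x ≟ 0#)) (∈-elements _) t≢0)

  δ0≢0 : δ 0# ≢ 0#
  δ0≢0 = withRoots-∉ units λ 0∈ → proj₂ (∈-filter⁻ (λ x → ¬? (x ≟ 0#)) {xs = elements} 0∈) refl

-- Counting in lists.

length-filter-split : ∀ {A : Set} {P : A → Set} (P? : ∀ x → Dec (P x)) xs →
                      length (filter P? xs) ℕ.+ length (filter (¬? ∘ P?) xs) ≡ length xs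
length-filter-split P? []       = refl
length-filter-split P? (x ∷ xs) with P? x
... | yes _ = cong suc (length-filter-split P? xs)
... | no  _ = trans (ℕₚ.+-suc _ _) (cong suc (length-filter-split P? xs))

length-filter-filter : ∀ {A : Set} {P Q : A → Set} (P? : ∀ x → Dec (P x)) (Q? : ∀ x → Dec (Q x)) xs →
                       length (filter P? (filter Q? xs)) ≤ length (filter P? xs)
length-filter-filter P? Q? []       = z≤n
length-filter-filter P? Q? (x ∷ xs) with Q? x
... | yes _ with P? x
...   | yes _ = s≤s (length-filter-filter P? Q? xs)
...   | no  _ = length-filter-filter P? Q? xs
length-filter-filter P? Q? (x ∷ xs) | no _ with P? x
...   | yes _ = ℕₚ.m≤n⇒m≤1+n (length-filter-filter P? Q? xs)
...   | no  _ = length-filter-filter P? Q? xs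

-- Entries satisfying the first predicate number at most k; the remaining entries are covered by the
-- other predicates, and filtering a sublist does not increase their counts.
pigeonhole-≤ : ∀ {A : Set} k p {P : Fin p → A → Set} (P? : ∀ b x → Dec (P b x)) xs →
               (∀ {x} → x ∈ xs → ∃ λ b → P b x) →
               (∀ b → length (filter (P? b) xs) ≤ k) → length xs ≤ p ℕ.* k
pigeonhole-≤ k zero    P? []       cover small = z≤n
pigeonhole-≤ k zero    P? (x ∷ xs) cover small with cover (here refl)
... | () , _
pigeonhole-≤ k (suc p) {P} P? xs cover small =
  subst (_≤ k ℕ.+ p ℕ.* k) (length-filter-split (P? zero) xs)
    (ℕₚ.+-mono-≤ (small zero) (pigeonhole-≤ k p (P? ∘ suc) rest cover′
      λ b → ℕₚ.≤-trans (length-filter-filter (P? (suc b)) (¬? ∘ P? zero) xs) (small (suc b))))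
  where
  rest = filter (¬? ∘ P? zero) xs
  cover′ : ∀ {x} → x ∈ rest → ∃ λ b → P (suc b) x
  cover′ x∈ with ∈-filter⁻ (¬? ∘ P? zero) {xs = xs} x∈
  ... | x∈xs , ¬P₀ with cover x∈xs
  ...   | zero  , P₀ = contradiction P₀ ¬P₀
  ...   | suc b , Pb = b , Pb

-- Hyperplanes and words restricted to a parametrized plane.

module Support {q : ℕ} (F : FiniteField q) (n : ℕ) where
  open FiniteField F renaming (_+_ to infixl 6 _+_; _*_ to infixl 7 _*_; -_ to infix 8 -_; _≟_ to infix 4 _≟_; _⁻¹ to infix 9 _⁻¹)
  open Field F
  open PG F n using (dot; isNormalized)
  open ≡-Reasoning

  V : Set
  V = Vec Carrier (suc n)

  0V : ∀ {m} → Vec Carrier m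
  0V = replicate _ 0#

  dot-0V : ∀ {m} (a : Vec Carrier m) → dot a 0V ≡ 0#
  dot-0V []       = refl
  dot-0V (a ∷ as) = trans (cong₂ _+_ (zeroʳ a) (dot-0V as)) (+-identityˡ 0#)

  point : ∀ {m} (P R Q : Vec Carrier m) → Carrier → Carrier → Vec Carrier m
  point []      []      []      x y = []
  point (p ∷ P) (r ∷ R) (s ∷ Q) x y = (p * (1# + - y) + r * x + s * y) ∷ point P R Q x y

  -- The coefficients of 1, x and y in the linear form a evaluated at `point P R Q x y`.
  form : ∀ {m} (a P R Q : Vec Carrier m) → Affine
  form a P R Q = dot a P , dot a R , dot a Q + - dot a P

  dot-point′ : ∀ {m} (a P R Q : Vec Carrier m) x y →
               dot a (point P R Q x y) ≡ dot a P * (1# + - y) + dot a R * x + dot a Q * y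
  dot-point′ [] [] [] [] x y = solve 3 (λ t x y → con 0 := con 0 :* t :+ con 0 :* x :+ con 0 :* y) refl (1# + - y) x y
  dot-point′ (a ∷ as) (p ∷ P) (r ∷ R) (s ∷ Q) x y = trans
    (cong (a * (p * (1# + - y) + r * x + s * y) +_) (dot-point′ as P R Q x y))
    (solve 10 (λ a p r s x y t dP dR dQ →
       a :* (p :* t :+ r :* x :+ s :* y) :+ (dP :* t :+ dR :* x :+ dQ :* y) :=
       (a :* p :+ dP) :* t :+ (a :* r :+ dR) :* x :+ (a :* s :+ dQ) :* y) refl
       a p r s x y (1# + - y) (dot as P) (dot as R) (dot as Q))

  dot-point : ∀ {m} (a P R Q : Vec Carrier m) x y → dot a (point P R Q x y) ≡ at (form a P R Q) x y
  dot-point a P R Q x y = begin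
    dot a (point P R Q x y)           ≡⟨ dot-point′ a P R Q x y ⟩
    u * (1# + - y) + v * x + w * y    ≡⟨ solve 6 (λ u v w x y z → u :* (con 1 :+ z) :+ v :* x :+ w :* y :=
                                           u :+ v :* x :+ (w :* y :+ u :* z)) refl u v w x y (- y) ⟩
    u + v * x + (w * y + u * - y)     ≡⟨ cong (λ t → u + v * x + (w * y + t)) (trans (sym (-‿distribʳ-* u y)) (-‿distribˡ-* u y)) ⟩
    u + v * x + (w * y + - u * y)     ≡⟨ cong (u + v * x +_) (distribʳ y w (- u)) ⟨
    u + v * x + (w + - u) * y         ∎
    where
    u = dot a P
    v = dot a R
    w = dot a Q

  point-0-0 : ∀ {m} (P R Q : Vec Carrier m) → point P R Q 0# 0# ≡ P
  point-0-0 []      []      []      = refl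
  point-0-0 (p ∷ P) (r ∷ R) (s ∷ Q) = cong₂ _∷_
    (trans (solve 4 (λ p r s z → p :* (con 1 :+ z) :+ r :* con 0 :+ s :* con 0 := p :+ p :* z) refl p r s (- 0#))
      (trans (cong (λ t → p + p * t) (trans (sym (+-identityˡ _)) (-‿inverseʳ 0#))) (trans (cong (p +_) (zeroʳ p)) (+-identityʳ p))))
    (point-0-0 P R Q)

  point-0-1 : ∀ {m} (P R Q : Vec Carrier m) → point P R Q 0# 1# ≡ Q
  point-0-1 []      []      []      = refl
  point-0-1 (p ∷ P) (r ∷ R) (s ∷ Q) = cong₂ _∷_
    (trans (cong (λ t → p * t + r * 0# + s * 1#) (-‿inverseʳ 1#))
      (solve 3 (λ p r s → p :* con 0 :+ r :* con 0 :+ s :* con 1 := s) refl p r s))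
    (point-0-1 P R Q)

  𝟙 : V → V → Carrier
  𝟙 a v = if does (dot a v ≟ 0#) then 1# else 0#

  𝟙-∈ : ∀ {a v} → dot a v ≡ 0# → 𝟙 a v ≡ 1#
  𝟙-∈ {a} {v} av≡0 with dot a v ≟ 0#
  ... | yes _    = refl
  ... | no  av≢0 = contradiction av≡0 av≢0

  𝟙-∉ : ∀ {a v} → dot a v ≢ 0# → 𝟙 a v ≡ 0#
  𝟙-∉ {a} {v} av≢0 with dot a v ≟ 0#
  ... | yes av≡0 = contradiction av≡0 av≢0
  ... | no  _    = refl

  δ-𝟙 : ∀ a v → δ 0# * 𝟙 a v ≡ δ (dot a v)
  δ-𝟙 a v with dot a v ≟ 0#
  ... | yes av≡0 = trans (*-identityʳ _) (cong δ (sym av≡0))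
  ... | no  av≢0 = trans (zeroʳ _) (sym (δ-nonzero av≢0))

  -- The codeword Σⱼ cⱼ Lⱼ, as a function on all of F^{n+1} with values in F.
  val : ∀ {K} → (Fin K → ℕ) → (Fin K → V) → V → Carrier
  val c L v = sum λ j → ι (c j) * 𝟙 (L j) v

  -- The indicators are 0 or 1, so values stay in the prime field; this leaves only p candidates for
  -- a value.
  val-ι : ∀ {K} (c : Fin K → ℕ) L v → ∃ λ N → val c L v ≡ ι N
  val-ι {zero}  c L v = 0 , refl
  val-ι {suc K} c L v with val-ι (c ∘ suc) (L ∘ suc) v | dot (L zero) v ≟ 0#
  ... | N , eq | yes _ = c zero ℕ.+ N , trans (cong₂ _+_ (*-identityʳ _) eq) (sym (ι-+ (c zero) N))
  ... | N , eq | no  _ = N , trans (cong₂ _+_ (zeroʳ _) eq) (+-identityˡ _)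

  module _ (P R Q : V) (ls : List Affine) (bound : length ls ℕ.+ 2 ≤ q) where

    -- Multiplied by δ(0), the indicator becomes a product of at most q - 1 affine functions. The at
    -- most q - 2 factors in `ls` keep the total at or below 2q - 3, where `∑∑-∏` gives zero.
    ∑∑-𝟙-∏ : ∀ a → ∑∑ (λ x y → 𝟙 a (point P R Q x y) * ∏ ls x y) ≡ 0#
    ∑∑-𝟙-∏ a = integral (begin
      δ 0# * ∑∑ (λ x y → 𝟙 a (point P R Q x y) * ∏ ls x y)     ≡⟨ ∑∑-* (δ 0#) (λ x y → 𝟙 a (point P R Q x y) * ∏ ls x y) ⟨
      ∑∑ (λ x y → δ 0# * (𝟙 a (point P R Q x y) * ∏ ls x y))   ≡⟨ ∑∑-cong pointwise ⟩
      ∑∑ (∏ (map (shift (form a P R Q)) units ++ ls))          ≡⟨ ∑∑-∏ (map (shift (form a P R Q)) units ++ ls) bound′ ⟩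
      0#                                                       ∎) δ0≢0
      where
      pointwise : ∀ x y → δ 0# * (𝟙 a (point P R Q x y) * ∏ ls x y) ≡ ∏ (map (shift (form a P R Q)) units ++ ls) x y
      pointwise x y = begin
        δ 0# * (𝟙 a (point P R Q x y) * ∏ ls x y)           ≡⟨ *-assoc _ _ _ ⟨
        δ 0# * 𝟙 a (point P R Q x y) * ∏ ls x y             ≡⟨ cong (_* ∏ ls x y) (δ-𝟙 a (point P R Q x y)) ⟩
        δ (dot a (point P R Q x y)) * ∏ ls x y              ≡⟨ cong (λ t → δ t * ∏ ls x y) (dot-point a P R Q x y) ⟩
        δ (at (form a P R Q) x y) * ∏ ls x y                ≡⟨ cong (_* ∏ ls x y) (∏-shift (form a P R Q) units x y) ⟨
        ∏ (map (shift (form a P R Q)) units) x y * ∏ ls x y ≡⟨ ∏-++ (map (shift (form a P R Q)) units) ls x y ⟨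
        ∏ (map (shift (form a P R Q)) units ++ ls) x y      ∎
      bound′ : length (map (shift (form a P R Q)) units ++ ls) ℕ.+ 3 ≤ q ℕ.+ q
      bound′ = subst (_≤ q ℕ.+ q)
        (sym (trans (cong (ℕ._+ 3) (trans (length-++ (map (shift (form a P R Q)) units))
                                          (cong (ℕ._+ length ls) (length-map _ units))))
                    (trans (ℕₚ.+-assoc (length units) _ 3) (trans (cong (length units ℕ.+_) (ℕₚ.+-suc (length ls) 2))
                      (ℕₚ.+-suc (length units) _)))))
        (ℕₚ.+-mono-≤ length-units bound)

    ∑∑-val-∏ : ∀ {K} (c : Fin K → ℕ) L → ∑∑ (λ x y → val c L (point P R Q x y) * ∏ ls x y) ≡ 0#
    ∑∑-val-∏ {zero}  c L = trans (∑∑-cong λ x y → zeroˡ (∏ ls x y)) (∑F-zero λ _ → ∑F-zero λ _ → refl)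
    ∑∑-val-∏ {suc K} c L = begin
      ∑∑ (λ x y → val c L (point P R Q x y) * ∏ ls x y)
        ≡⟨ ∑∑-cong (λ x y → solve 4 (λ a b s r → (a :* b :+ s) :* r := a :* (b :* r) :+ s :* r) refl
             (ι (c zero)) (𝟙 (L zero) (point P R Q x y)) (val (c ∘ suc) (L ∘ suc) (point P R Q x y)) (∏ ls x y)) ⟩
      ∑∑ (λ x y → ι (c zero) * first x y + rest x y)
        ≡⟨ ∑∑-+ (λ x y → ι (c zero) * first x y) rest ⟩
      ∑∑ (λ x y → ι (c zero) * first x y) + ∑∑ rest
        ≡⟨ cong₂ _+_ (∑∑-* (ι (c zero)) first) (∑∑-val-∏ (c ∘ suc) (L ∘ suc)) ⟩
      ι (c zero) * ∑∑ first + 0#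
        ≡⟨ trans (+-identityʳ _) (cong (ι (c zero) *_) (∑∑-𝟙-∏ (L zero))) ⟩
      ι (c zero) * 0#
        ≡⟨ zeroʳ _ ⟩
      0# ∎
      where
      first rest : Carrier → Carrier → Carrier
      first x y = 𝟙 (L zero) (point P R Q x y) * ∏ ls x y
      rest  x y = val (c ∘ suc) (L ∘ suc) (point P R Q x y) * ∏ ls x y

  -- Words supported on a union of hyperplanes, along a line of one of them.

  Supported : ∀ {K} → (Fin K → ℕ) → (Fin K → V) → ∀ {k} → (Fin k → V) → Set
  Supported c L Hs = ∀ v → v ≢ 0V → (∀ i → dot (Hs i) v ≢ 0#) → val c L v ≡ 0#

  module Line {K} (c : Fin K → ℕ) (L : Fin K → V) {k} (H : V) (Hs : Fin k → V)
              (supported : Supported c L (H VF.∷ Hs))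
              (P R Q : V) (P∈H : dot H P ≡ 0#) (Q∈H : dot H Q ≡ 0#) (R∉H : dot H R ≢ 0#) where

    forms : List Affine
    forms = tabulate λ i → form (Hs i) P R Q

    u : Carrier → Carrier
    u y = val c L (point P R Q 0# y) * ∏ forms 0# y

    -- The form H takes the value x times `dot H R` here, so the vector lies off H. Either another
    -- hyperplane contains it and its form kills the product, or the vector is off all of them and
    -- the word vanishes.
    off-line : ∀ x y → x ≢ 0# → val c L (point P R Q x y) * ∏ forms x y ≡ 0#
    off-line x y x≢0 with any? (λ i → dot (Hs i) (point P R Q x y) ≟ 0#)
    ... | yes (i , ≡0) = trans (cong (val c L (point P R Q x y) *_)
                           (∏-tabulate-zero (λ i → form (Hs i) P R Q) i (trans (sym (dot-point (Hs i) P R Q x y)) ≡0)))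
                           (zeroʳ _)
    ... | no none = trans (cong (_* ∏ forms x y) (supported (point P R Q x y) v≢0 v∉)) (zeroˡ _)
      where
      v∉H : dot H (point P R Q x y) ≢ 0#
      v∉H eq = *-nonzero R∉H x≢0 (begin
        dot H R * x                                         ≡⟨ solve 4 (λ a b x y → b :* x := con 0 :* a :+ b :* x :+ con 0 :* y) refl (1# + - y) (dot H R) x y ⟩
        0# * (1# + - y) + dot H R * x + 0# * y              ≡⟨ cong₂ (λ s t → s * (1# + - y) + dot H R * x + t * y) P∈H Q∈H ⟨
        dot H P * (1# + - y) + dot H R * x + dot H Q * y    ≡⟨ dot-point′ H P R Q x y ⟨
        dot H (point P R Q x y)                             ≡⟨ eq ⟩
        0#                                                  ∎)
      v≢0 : point P R Q x y ≢ 0V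
      v≢0 eq = v∉H (trans (cong (dot H) eq) (dot-0V H))
      v∉ : ∀ i → dot ((H VF.∷ Hs) i) (point P R Q x y) ≢ 0#
      v∉ zero    = v∉H
      v∉ (suc i) eq = none (i , eq)

    zeros : List Carrier
    zeros = filter (λ y → u y ≟ 0#) elements

    -- With more than k zeros there would be few enough nonzeros that factors y - z can kill all of
    -- them except y₀ within the degree bound. The sum over the plane would then be its single term
    -- at (0, y₀), which is nonzero, against `∑∑-val-∏`.
    few-zeros : ∀ y₀ → u y₀ ≢ 0# → length zeros ≤ k
    few-zeros y₀ uy₀≢0 = ℕₚ.≮⇒≥ λ k<zeros → nonvanishing (trans (sym concentrated)
      (∑∑-val-∏ P R Q (forms ++ map (shift Y) roots) (bound k<zeros) c L))
      where
      nonzeros′ = filter (λ y → ¬? (u y ≟ 0#)) elements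
      roots     = filter (λ y → ¬? (y ≟ y₀)) nonzeros′
      -- The coordinate function (x, y) ↦ y, whose shifts are the factors y - z.
      Y : Affine
      Y = 0# , 0# , 1#

      -- The summand 2 is paid for twice by one: by the strict inequality k < `length zeros`, and by
      -- y₀ being a nonzero that is not among the roots.
      bound : k < length zeros → length (forms ++ map (shift Y) roots) ℕ.+ 2 ≤ q
      bound k<zeros = LE.begin
        length (forms ++ map (shift Y) roots) ℕ.+ 2
          LE.≡⟨ cong (ℕ._+ 2) (trans (length-++ forms) (cong₂ ℕ._+_ (length-tabulate _) (length-map _ roots))) ⟩
        k ℕ.+ length roots ℕ.+ 2
          LE.≡⟨ trans (ℕₚ.+-suc _ 1) (cong suc (trans (ℕₚ.+-suc _ 0) (trans (cong suc (ℕₚ.+-identityʳ _)) (sym (ℕₚ.+-suc k _))))) ⟩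
        suc k ℕ.+ suc (length roots)
          LE.≤⟨ ℕₚ.+-mono-≤ k<zeros (filter-notAll (λ y → ¬? (y ≟ y₀)) nonzeros′
               (lose (∈-filter⁺ (λ y → ¬? (u y ≟ 0#)) (∈-elements y₀) uy₀≢0) λ ≢ → ≢ refl)) ⟩
        length zeros ℕ.+ length nonzeros′
          LE.≡⟨ trans (length-filter-split (λ y → u y ≟ 0#) elements) (length-tabulate elem) ⟩
        q LE.∎
        where module LE = ℕₚ.≤-Reasoning

      g : Carrier → Carrier → Carrier
      g x y = val c L (point P R Q x y) * ∏ (forms ++ map (shift Y) roots) x y

      g-split : ∀ x y → g x y ≡ val c L (point P R Q x y) * ∏ forms x y * withRoots roots y
      g-split x y = begin
        g x y ≡⟨ cong (val c L (point P R Q x y) *_) (trans (∏-++ forms _ x y) (cong (∏ forms x y *_) (∏-shift Y roots x y))) ⟩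
        val c L (point P R Q x y) * (∏ forms x y * withRoots roots (0# + 0# * x + 1# * y))
          ≡⟨ *-assoc _ _ _ ⟨
        val c L (point P R Q x y) * ∏ forms x y * withRoots roots (0# + 0# * x + 1# * y)
          ≡⟨ cong (λ t → val c L (point P R Q x y) * ∏ forms x y * withRoots roots t)
               (solve 2 (λ x y → con 0 :+ con 0 :* x :+ con 1 :* y := y) refl x y) ⟩
        val c L (point P R Q x y) * ∏ forms x y * withRoots roots y ∎

      g-off : ∀ y → y ≢ y₀ → g 0# y ≡ 0#
      g-off y y≢y₀ with u y ≟ 0#
      ... | yes uy≡0 = trans (g-split 0# y) (trans (cong (_* withRoots roots y) uy≡0) (zeroˡ _))
      ... | no  uy≢0 = trans (g-split 0# y) (trans (cong (u y *_) (withRoots-∈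
            (∈-filter⁺ (λ y → ¬? (y ≟ y₀)) (∈-filter⁺ (λ y → ¬? (u y ≟ 0#)) (∈-elements y) uy≢0) y≢y₀))) (zeroʳ _))

      concentrated : ∑∑ g ≡ g 0# y₀
      concentrated = trans
        (∑F-single (λ x → ∑F (g x)) 0# λ x x≢0 → ∑F-zero λ y →
          trans (g-split x y) (trans (cong (_* withRoots roots y) (off-line x y x≢0)) (zeroˡ _)))
        (∑F-single (g 0#) y₀ g-off)

      nonvanishing : g 0# y₀ ≢ 0#
      nonvanishing eq = *-nonzero uy₀≢0 (withRoots-∉ roots λ y₀∈ →
        proj₂ (∈-filter⁻ (λ y → ¬? (y ≟ y₀)) {xs = nonzeros′} y₀∈) refl) (trans (sym (g-split 0# y₀)) eq)

  -- The prime field, and words determined by their support.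

  module Characteristic (p : ℕ) .{{_ : NonZero p}} (ιp≡0 : ι p ≡ 0#) where

    -- Coefficients of words are natural numbers, so p ∸ b serves as - b.
    ι-∸ : ∀ {b} → b ≤ p → ι (p ∸ b) + ι b ≡ 0#
    ι-∸ {b} b≤p = trans (sym (ι-+ (p ∸ b) b)) (trans (cong ι (ℕₚ.m∸n+n≡m b≤p)) ιp≡0)

    ι-mod : ∀ N → ι (toℕ (N mod p)) ≡ ι N
    ι-mod N = begin
      ι (toℕ (N mod p))                      ≡⟨ cong ι (toℕ-fromℕ< (m%n<n N p)) ⟩
      ι (N % p)                              ≡⟨ +-identityʳ _ ⟨
      ι (N % p) + 0#                         ≡⟨ cong (ι (N % p) +_) (trans (cong (ι (N / p) *_) ιp≡0) (zeroʳ _)) ⟨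
      ι (N % p) + ι (N / p) * ι p            ≡⟨ cong (ι (N % p) +_) (ι-* (N / p) p) ⟨
      ι (N % p) + ι (N / p ℕ.* p)            ≡⟨ ι-+ (N % p) _ ⟨
      ι (N % p ℕ.+ N / p ℕ.* p)              ≡⟨ cong ι (m≡m%n+[m/n]*n N p) ⟨
      ι N                                    ∎

    -- Were no translate w − bH to vanish identically on the line PQ, each of the p values
    -- would be taken at most k times on its q affine points.
    constant-on-hyperplane : ∀ {K} (c : Fin K → ℕ) L {k} (H : V) (Hs : Fin k → V) → p ℕ.* k < q →
      Supported c L (H VF.∷ Hs) → ∀ {R} → dot H R ≢ 0# →
      ∀ P Q → dot H P ≡ 0# → dot H Q ≡ 0# → (∀ i → dot (Hs i) P ≢ 0#) → (∀ i → dot (Hs i) Q ≢ 0#) →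
      val c L P ≡ val c L Q
    constant-on-hyperplane c L {k} H Hs pk<q supported {R} R∉H P Q P∈H Q∈H P∉Hs Q∉Hs =
      conclude (any? λ b → ¬? (∃? λ y → ¬? (u b y ≟ 0#)))
      where
      -- The word w - bH is again a combination of hyperplanes, and off H it agrees with w, so the
      -- bound of `few-zeros` holds for every b.
      module Translate (b : Fin p) where
        c′ = (p ∸ toℕ b) VF.∷ c
        L′ = H VF.∷ L
        supported′ : Supported c′ L′ (H VF.∷ Hs)
        supported′ v v≢0 v∉ = trans
          (cong₂ _+_ (trans (cong (ι (p ∸ toℕ b) *_) (𝟙-∉ {H} {v} (v∉ zero))) (zeroʳ _)) (supported v v≢0 v∉))
          (+-identityʳ 0#)
        open Line c′ L′ H Hs supported′ P R Q P∈H Q∈H R∉H public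
        val-∈ : ∀ {v} → dot H v ≡ 0# → val c′ L′ v ≡ ι (p ∸ toℕ b) + val c L v
        val-∈ {v} v∈H = cong (_+ val c L v) (trans (cong (ι (p ∸ toℕ b) *_) (𝟙-∈ {H} {v} v∈H)) (*-identityʳ _))
      open Translate using (u; zeros; few-zeros; val-∈)

      line∈H : ∀ y → dot H (point P R Q 0# y) ≡ 0#
      line∈H y = begin
        dot H (point P R Q 0# y)                           ≡⟨ dot-point′ H P R Q 0# y ⟩
        dot H P * (1# + - y) + dot H R * 0# + dot H Q * y  ≡⟨ cong₂ (λ s t → s * (1# + - y) + dot H R * 0# + t * y) P∈H Q∈H ⟩
        0# * (1# + - y) + dot H R * 0# + 0# * y            ≡⟨ solve 3 (λ a b y → con 0 :* a :+ b :* con 0 :+ con 0 :* y := con 0) refl (1# + - y) (dot H R) y ⟩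
        0#                                                 ∎

      -- At a vector off the other hyperplanes the product of the forms is nonzero, so the vanishing
      -- of `u b` passes to the translate itself.
      value : ∀ b → ¬ (∃ λ y → u b y ≢ 0#) → ∀ y {v} → point P R Q 0# y ≡ v →
              (∀ i → dot (Hs i) v ≢ 0#) → ι (p ∸ toℕ b) + val c L v ≡ 0#
      value b none y refl v∉Hs = trans (sym (val-∈ b (line∈H y))) (integral
        (trans (*-comm _ _) (decidable-stable (u b y ≟ 0#) λ ≢0 → none (y , ≢0)))
        (∏-tabulate-nonzero (λ i → form (Hs i) P R Q) λ i eq → v∉Hs i (trans (dot-point (Hs i) P R Q 0# y) eq)))

      -- The value of w at this vector is N times 1, and subtracting (N mod p)H cancels it.
      covered : ∀ y → ∃ λ b → u b y ≡ 0#
      covered y with val-ι c L (point P R Q 0# y)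
      ... | N , eq = b , trans (cong (_* ∏ (Translate.forms b) 0# y)
              (trans (val-∈ b (line∈H y)) (trans (cong (ι (p ∸ toℕ b) +_) (trans eq (sym (ι-mod N))))
                (ι-∸ (ℕₚ.<⇒≤ (toℕ<n b)))))) (zeroˡ _)
        where b = N mod p

      conclude : Dec (∃ λ b → ¬ (∃ λ y → u b y ≢ 0#)) → val c L P ≡ val c L Q
      -- P and Q are the vectors with y = 0 and y = 1 on the line.
      conclude (yes (b , none)) = +-cancelˡ (ι (p ∸ toℕ b)) _ _
        (trans (value b none 0# (point-0-0 P R Q) P∉Hs) (sym (value b none 1# (point-0-1 P R Q) Q∉Hs)))
      conclude (no all-nonzero) = contradiction pk<q (ℕₚ.≤⇒≯
        (subst (_≤ p ℕ.* k) (length-tabulate elem)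
          (pigeonhole-≤ k p (λ b y → u b y ≟ 0#) elements (λ {y} _ → covered y) small)))
        where
        small : ∀ b → length (zeros b) ≤ k
        small b = let (y , ≢0) = decidable-stable (∃? λ y → ¬? (u b y ≟ 0#)) (λ none → all-nonzero (b , none))
                  in few-zeros b y ≢0

    -- Induction on k. If no vector of H avoids the other hyperplanes, they already cover H, which
    -- gets coefficient 0. Otherwise the constant value of the word on the uncovered part of H is
    -- subtracted as a multiple of H, and the rest is supported on the others.
    spanned-by-support : ∀ {k} (Hs : Fin k → V) → (∀ i → ∃ λ R → dot (Hs i) R ≢ 0#) → p ℕ.* k < q →
      ∀ {K} (c : Fin K → ℕ) L → Supported c L Hs →
      Σ (Fin k → ℕ) λ β → ∀ v → v ≢ 0V → val c L v ≡ val β Hs v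
    spanned-by-support {zero}  Hs proper pk<q c L supported = (λ ()) , λ v v≢0 → supported v v≢0 λ ()
    spanned-by-support {suc k} Hs proper pk<q c L supported =
      -- The search admits the zero vector, which can be found only when there are no other
      -- hyperplanes; `constant-on-hyperplane` allows it.
      extend (∃Vec? (suc n) λ P → (dot H P ≟ 0#) ×-dec all? λ i → ¬? (dot (Hs′ i) P ≟ 0#))
      where
      H   = Hs zero
      Hs′ = Hs ∘ suc
      pk<q′ : p ℕ.* k < q
      pk<q′ = ℕₚ.≤-<-trans (ℕₚ.*-monoʳ-≤ p (ℕₚ.n≤1+n k)) pk<q
      supported∷ : Supported c L (H VF.∷ Hs′)
      supported∷ v v≢0 v∉ = supported v v≢0 λ { zero → v∉ zero ; (suc i) → v∉ (suc i) }
      extend : Dec (∃ λ P → dot H P ≡ 0# × (∀ i → dot (Hs′ i) P ≢ 0#)) →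
               Σ (Fin (suc k) → ℕ) λ β → ∀ v → v ≢ 0V → val c L v ≡ val β Hs v
      extend (no none) =
        let (β , eq) = spanned-by-support Hs′ (proper ∘ suc) pk<q′ c L supported′
        in 0 VF.∷ β , λ v v≢0 → trans (eq v v≢0) (sym (trans (cong (_+ val β Hs′ v) (zeroˡ _)) (+-identityˡ _)))
        where
        supported′ : Supported c L Hs′
        supported′ v v≢0 v∉ with dot H v ≟ 0#
        ... | yes v∈H = contradiction (v , v∈H , v∉) none
        ... | no  v∉H = supported∷ v v≢0 λ { zero → v∉H ; (suc i) → v∉ i }
      extend (yes (P , P∈H , P∉)) =
        let (β , eq) = spanned-by-support Hs′ (proper ∘ suc) pk<q′ ((p ∸ toℕ b) VF.∷ c) (H VF.∷ L) supported′
        in toℕ b VF.∷ β , λ v v≢0 → begin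
          val c L v                                                      ≡⟨ +-identityˡ _ ⟨
          0# + val c L v                                                 ≡⟨ cong (_+ val c L v) (trans (cong (_* 𝟙 H v) (ι-∸ b≤p)) (zeroˡ _)) ⟨
          (ι (p ∸ toℕ b) + ι (toℕ b)) * 𝟙 H v + val c L v                ≡⟨ solve 4 (λ s t x r → (s :+ t) :* x :+ r := t :* x :+ (s :* x :+ r)) refl
                                                                              (ι (p ∸ toℕ b)) (ι (toℕ b)) (𝟙 H v) (val c L v) ⟩
          ι (toℕ b) * 𝟙 H v + (ι (p ∸ toℕ b) * 𝟙 H v + val c L v)        ≡⟨ cong (ι (toℕ b) * 𝟙 H v +_) (eq v v≢0) ⟩
          ι (toℕ b) * 𝟙 H v + val β Hs′ v                                ∎
        where
        -- The value of the word at P, as a residue modulo p.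
        b = proj₁ (val-ι c L P) mod p
        b≤p = ℕₚ.<⇒≤ (toℕ<n b)
        supported′ : Supported ((p ∸ toℕ b) VF.∷ c) (H VF.∷ L) Hs′
        supported′ v v≢0 v∉ with dot H v ≟ 0#
        ... | no v∉H  = trans (cong₂ _+_ (zeroʳ _)
                          (supported∷ v v≢0 λ { zero → v∉H ; (suc i) → v∉ i })) (+-identityʳ 0#)
        ... | yes v∈H = begin
          ι (p ∸ toℕ b) * 1# + val c L v ≡⟨ cong₂ _+_ (*-identityʳ _) (constant-on-hyperplane c L H Hs′ pk<q′ supported∷
                                             (proj₂ (proper zero)) v P v∈H P∈H v∉ P∉) ⟩
          ι (p ∸ toℕ b) + val c L P      ≡⟨ cong (ι (p ∸ toℕ b) +_) (trans (proj₂ (val-ι c L P)) (sym (ι-mod _))) ⟩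
          ι (p ∸ toℕ b) + ι (toℕ b)      ≡⟨ ι-∸ b≤p ⟩
          0#                             ∎

    module _ (prime : Prime p) where

      ι-multiple : ∀ x → ι (x ℕ.* p) ≡ 0#
      ι-multiple x = trans (ι-* x p) (trans (cong (ι x *_) ιp≡0) (zeroʳ _))

      -- Bézout coefficients for p and a. In the case 1 + y a = x p the inverse is - y, written (p -
      -- 1) y. The inverse is a natural number so that ratios can later be reduced to `Fin p`.
      ι-unit : ∀ {a} → a < p → a ≢ 0 → ∃ λ b → ι b * ι a ≡ 1#
      ι-unit {zero}      a<p a≢0 = contradiction refl a≢0
      ι-unit {a@(suc _)} a<p a≢0 with coprime-Bézout (prime⇒coprime prime a<p)
      ... | Bézout.-+ x y eq = y , (begin
        ι y * ι a              ≡⟨ ι-* y a ⟨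
        ι (y ℕ.* a)            ≡⟨ cong ι eq ⟨
        1# + ι (x ℕ.* p)       ≡⟨ cong (1# +_) (ι-multiple x) ⟩
        1# + 0#                ≡⟨ +-identityʳ 1# ⟩
        1#                     ∎)
      ... | Bézout.+- x y eq = (p ∸ 1) ℕ.* y , +-cancelˡ (ι (p ∸ 1)) _ _ (begin
        ι (p ∸ 1) + ι ((p ∸ 1) ℕ.* y) * ι a ≡⟨ cong (λ t → ι (p ∸ 1) + t * ι a) (ι-* (p ∸ 1) y) ⟩
        ι (p ∸ 1) + ι (p ∸ 1) * ι y * ι a   ≡⟨ solve 3 (λ s y a → s :+ s :* y :* a := s :* (con 1 :+ y :* a)) refl (ι (p ∸ 1)) (ι y) (ι a) ⟩
        ι (p ∸ 1) * (1# + ι y * ι a)        ≡⟨ cong (λ t → ι (p ∸ 1) * (1# + t)) (ι-* y a) ⟨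
        ι (p ∸ 1) * ι (suc (y ℕ.* a))       ≡⟨ cong (ι (p ∸ 1) *_) (trans (cong ι eq) (ι-multiple x)) ⟩
        ι (p ∸ 1) * 0#                      ≡⟨ zeroʳ _ ⟩
        0#                                  ≡⟨ ι-∸ (ℕ.>-nonZero⁻¹ p) ⟨
        ι (p ∸ 1) + ι 1                     ≡⟨ cong (ι (p ∸ 1) +_) (+-identityʳ 1#) ⟩
        ι (p ∸ 1) + 1#                      ∎)

      ι-≢0 : ∀ {a} → a < p → a ≢ 0 → ι a ≢ 0#
      ι-≢0 a<p a≢0 ιa≡0 = let (b , eq) = ι-unit a<p a≢0 in
        0≢1 (trans (sym (zeroʳ (ι b))) (trans (cong (ι b *_) (sym ιa≡0)) eq))

      ι-≡0 : ∀ {a} → a < p → ι a ≡ 0# → a ≡ 0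
      ι-≡0 {a} a<p ιa≡0 = decidable-stable (a ℕ.≟ 0) λ a≢0 → ι-≢0 a<p a≢0 ιa≡0

      ι-injective-≤ : ∀ {a b} → a ≤ b → b < p → ι a ≡ ι b → a ≡ b
      ι-injective-≤ {a} {b} a≤b b<p eq = ℕₚ.≤-antisym a≤b (ℕₚ.m∸n≡0⇒m≤n
        (ι-≡0 (ℕₚ.≤-<-trans (ℕₚ.m∸n≤m b a) b<p) (+-cancelˡ-0 {ι a} (trans eq
          (trans (cong ι (sym (ℕₚ.m+[n∸m]≡n a≤b))) (ι-+ a (b ∸ a)))))))

      -- Allows equality of word values, residues modulo p, to be verified in F.
      ι-toℕ-injective : ∀ {i j : Fin p} → ι (toℕ i) ≡ ι (toℕ j) → i ≡ j
      ι-toℕ-injective {i} {j} eq with ℕₚ.≤-total (toℕ i) (toℕ j)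
      ... | inj₁ i≤j = toℕ-injective (ι-injective-≤ i≤j (toℕ<n j) eq)
      ... | inj₂ j≤i = sym (toℕ-injective (ι-injective-≤ j≤i (toℕ<n i) (sym eq)))

  -- Vectors and their normalized representatives.

  tail-≢0V : ∀ {m x} {v : Vec Carrier m} → x ≡ 0# → (x ∷ v) ≢ 0V → v ≢ 0V
  tail-≢0V refl xv≢0 refl = xv≢0 refl

  head-≢0# : ∀ {m x} {v : Vec Carrier m} → x ≢ 0# → (x ∷ v) ≢ 0V
  head-≢0# x≢0 refl = x≢0 refl

  normalized-≢0V : ∀ {m} (v : Vec Carrier m) → T (isNormalized v) → v ≢ 0V
  normalized-≢0V (x ∷ v) norm with x ≟ 0#
  ... | yes _   = λ { refl → normalized-≢0V v norm refl }
  ... | no  x≢0 = head-≢0# x≢0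

  -- A unit vector at the first nonzero coordinate of a works; it provides the vector R outside a
  -- hyperplane.
  ≢0V-proper : ∀ {m} (a : Vec Carrier m) → a ≢ 0V → ∃ λ R → dot a R ≢ 0#
  ≢0V-proper []       a≢0 = contradiction refl a≢0
  ≢0V-proper (x ∷ a) xa≢0 with x ≟ 0#
  ... | yes x≡0 = let (R , aR≢0) = ≢0V-proper a (tail-≢0V x≡0 xa≢0) in
                  0# ∷ R , λ eq → aR≢0 (trans (sym (trans (cong (_+ dot a R) (zeroʳ x)) (+-identityˡ _))) eq)
  ... | no  x≢0 = 1# ∷ 0V , λ eq → x≢0 (trans (sym (trans (cong₂ _+_ (*-identityʳ x) (dot-0V a)) (+-identityʳ x))) eq)

  scale : ∀ {m} → Carrier → Vec Carrier m → Vec Carrier m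
  scale s = Vec.map (s *_)

  -- Scaling by the inverse of the first nonzero coordinate; this carries statements about points
  -- over to arbitrary nonzero vectors.
  normalize : ∀ {m} (v : Vec Carrier m) → v ≢ 0V → ∃ λ s → s ≢ 0# × T (isNormalized (scale s v))
  normalize []      v≢0 = contradiction refl v≢0
  normalize (x ∷ v) xv≢0 with x ≟ 0#
  ... | yes x≡0 with normalize v (tail-≢0V x≡0 xv≢0)
  ...   | s , s≢0 , norm = s , s≢0 , skip
    where
    skip : T (isNormalized (s * x ∷ scale s v))
    skip with s * x ≟ 0#
    ... | yes _    = norm
    ... | no  sx≢0 = contradiction (trans (cong (s *_) x≡0) (zeroʳ s)) sx≢0
  normalize (x ∷ v) xv≢0 | no x≢0 = x ⁻¹ , x⁻¹≢0 , leading
    where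
    x⁻¹x≡1 : x ⁻¹ * x ≡ 1#
    x⁻¹x≡1 = trans (*-comm _ _) (⁻¹-inverse x x≢0)
    x⁻¹≢0 : x ⁻¹ ≢ 0#
    x⁻¹≢0 eq = 0≢1 (trans (sym (zeroˡ x)) (trans (cong (_* x) (sym eq)) x⁻¹x≡1))
    leading : T (isNormalized (x ⁻¹ * x ∷ scale (x ⁻¹) v))
    leading with x ⁻¹ * x ≟ 0# | x ⁻¹ * x ≟ 1#
    ... | yes eq | _      = contradiction (trans (sym eq) x⁻¹x≡1) 0≢1
    ... | no _   | yes _  = _
    ... | no _   | no ≢1  = contradiction x⁻¹x≡1 ≢1

  dot-scale : ∀ {m} s (a v : Vec Carrier m) → dot a (scale s v) ≡ s * dot a v
  dot-scale s []      []      = sym (zeroʳ s)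
  dot-scale s (a ∷ as) (x ∷ v) = trans (cong (a * (s * x) +_) (dot-scale s as v))
    (solve 4 (λ a s x d → a :* (s :* x) :+ s :* d := s :* (a :* x :+ d)) refl a s x (dot as v))

  𝟙-scale : ∀ {s} → s ≢ 0# → ∀ a v → 𝟙 a (scale s v) ≡ 𝟙 a v
  𝟙-scale {s} s≢0 a v with dot a v ≟ 0#
  ... | yes av≡0 = 𝟙-∈ {a} {scale s v} (trans (dot-scale s a v) (trans (cong (s *_) av≡0) (zeroʳ s)))
  ... | no  av≢0 = 𝟙-∉ {a} {scale s v} λ eq → *-nonzero s≢0 av≢0 (trans (sym (dot-scale s a v)) eq)

  val-scale : ∀ {K s} → s ≢ 0# → ∀ (c : Fin K → ℕ) L v → val c L (scale s v) ≡ val c L v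
  val-scale s≢0 c L v = sum-cong-≗ λ j → cong (ι (c j) *_) (𝟙-scale s≢0 (L j) v)

  -- Sums over the classes of an equivalence relation.

  module Classes {m} (R : Fin m → Fin m → Bool) (R-refl : ∀ i → T (R i i))
                 (R-sym : ∀ i j → T (R i j) → T (R j i)) (R-trans : ∀ i j k → T (R i j) → T (R j k) → T (R i k)) where

    classSum : (Fin m → Carrier) → Fin m → Carrier
    classSum a l = sum λ k → if R k l then a k else 0#

    ClassConstant : (Fin m → Carrier) → Set
    ClassConstant d = ∀ i j → T (R i j) → d i ≡ d j

    -- Removes one class from a weighted sum by zeroing its weights; the index set stays fixed, so
    -- no list of class representatives is needed.
    erase : Fin m → (Fin m → Carrier) → Fin m → Carrier
    erase l d k = if R k l then 0# else d k

    erase-∈ : ∀ l d k → T (R k l) → erase l d k ≡ 0#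
    erase-∈ l d k Rkl with true ← R k l = refl

    erase-∉ : ∀ l d k → ¬ T (R k l) → erase l d k ≡ d k
    erase-∉ l d k ¬Rkl with R k l
    ... | true  = contradiction _ ¬Rkl
    ... | false = refl

    erase-constant : ∀ l d → ClassConstant d → ClassConstant (erase l d)
    erase-constant l d const i j Rij with R i l in Ril | R j l in Rjl
    ... | true  | true  = refl
    ... | false | false = const i j Rij
    ... | true  | false = ⊥-elim (subst T Rjl (R-trans j i l (R-sym i j Rij) (subst T (sym Ril) _)))
    ... | false | true  = ⊥-elim (subst T Ril (R-trans i j l Rij (subst T (sym Rjl) _)))

    sum-erase : ∀ a l d → ClassConstant d →
                sum (λ k → d k * a k) ≡ d l * classSum a l + sum (λ k → erase l d k * a k)
    sum-erase a l d const = begin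
      sum (λ k → d k * a k)
        ≡⟨ sum-cong-≗ pointwise ⟩
      sum (λ k → d l * (if R k l then a k else 0#) + erase l d k * a k)
        ≡⟨ ∑-distrib-+ (λ k → d l * (if R k l then a k else 0#)) (λ k → erase l d k * a k) ⟩
      sum (λ k → d l * (if R k l then a k else 0#)) + sum (λ k → erase l d k * a k)
        ≡⟨ cong (_+ sum (λ k → erase l d k * a k)) (*-distribˡ-sum (d l) (λ k → if R k l then a k else 0#)) ⟨
      d l * classSum a l + sum (λ k → erase l d k * a k) ∎
      where
      pointwise : ∀ k → d k * a k ≡ d l * (if R k l then a k else 0#) + erase l d k * a k
      pointwise k with R k l in Rkl
      ... | true  = trans (cong (_* a k) (const k l (subst T (sym Rkl) _)))
                      (sym (trans (cong (d l * a k +_) (zeroˡ _)) (+-identityʳ _)))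
      ... | false = sym (trans (cong (_+ d k * a k) (zeroʳ _)) (+-identityˡ _))

    -- Each step erases the class of the head of the list. An entry whose class is already gone has
    -- weight 0 and contributes nothing, so the list may repeat classes; `covered` records that
    -- nonzero weights occur only on the rest of the list.
    sum-by-classes : ∀ a (ls : List (Fin m)) d → ClassConstant d → (∀ l → d l * classSum a l ≡ 0#) →
                     (∀ k → k ∈ ls ⊎ d k ≡ 0#) → sum (λ k → d k * a k) ≡ 0#
    sum-by-classes a [] d const zero-sums covered = sum-zero λ k → trans (cong (_* a k) (d≡0 k)) (zeroˡ _)
      where
      d≡0 : ∀ k → d k ≡ 0#
      d≡0 k with covered k
      ... | inj₂ eq = eq
    sum-by-classes a (l ∷ ls) d const zero-sums covered = trans (sum-erase a l d const) (trans
      (cong₂ _+_ (zero-sums l) (sum-by-classes a ls (erase l d) (erase-constant l d const) zero-sums′ covered′))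
      (+-identityʳ 0#))
      where
      zero-sums′ : ∀ i → erase l d i * classSum a i ≡ 0#
      zero-sums′ i with R i l
      ... | true  = zeroˡ _
      ... | false = zero-sums i
      covered′ : ∀ k → k ∈ ls ⊎ erase l d k ≡ 0#
      covered′ k with R k l in Rkl | covered k
      ... | true  | _                  = inj₂ refl
      ... | false | inj₂ eq            = inj₂ eq
      ... | false | inj₁ (there k∈ls)  = inj₁ k∈ls
      ... | false | inj₁ (here refl)   = ⊥-elim (subst T Rkl (R-refl k))

-- Coefficient ratios along the partitions of the hyperplanes of c.

module Minimality {q : ℕ} (F : FiniteField q) (n p : ℕ) .{{_ : NonZero p}} (prime : Prime p)
                  (ιp≡0 : Field.ι F p ≡ FiniteField.0# F) where
  open FiniteField F renaming (_+_ to infixl 6 _+_; _*_ to infixl 7 _*_; -_ to infix 8 -_; _≟_ to infix 4 _≟_; _⁻¹ to infix 9 _⁻¹)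
  open Field F
  open PG F n using (Point; Hyperplane; χ; dot)
  open PG.Code F n p
  open Support F n
  open Characteristic p ιp≡0
  open ≡-Reasoning

  ι-χ : ∀ (H : Hyperplane) (P : Point) → ι (χ H P) ≡ 𝟙 (proj₁ H) (proj₁ P)
  ι-χ (a , _) (v , _) with dot a v ≟ 0#
  ... | yes _ = +-identityʳ 1#
  ... | no  _ = refl

  ι-sumFin : ∀ k (f : Fin k → ℕ) → ι (sumFin k f) ≡ sum (ι ∘ f)
  ι-sumFin k f = trans (cong (ι ∘ ℕsum) (map-tabulate id f)) (go k f)
    where
    go : ∀ k (f : Fin k → ℕ) → ι (ℕsum (tabulate f)) ≡ sum (ι ∘ f)
    go zero    f = refl
    go (suc k) f = trans (ι-+ (f zero) _) (cong (ι (f zero) +_) (go k (f ∘ suc)))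

  ι-lincomb : ∀ k Hs (αs : Fin k → Fin p) P →
              ι (toℕ (lincomb k Hs αs P)) ≡ val (toℕ ∘ αs) (proj₁ ∘ Hs) (proj₁ P)
  ι-lincomb k Hs αs P = begin
    ι (toℕ (lincomb k Hs αs P))                       ≡⟨ ι-mod (sumFin k λ i → toℕ (αs i) ℕ.* χ (Hs i) P) ⟩
    ι (sumFin k λ i → toℕ (αs i) ℕ.* χ (Hs i) P)      ≡⟨ ι-sumFin k _ ⟩
    sum (λ i → ι (toℕ (αs i) ℕ.* χ (Hs i) P))         ≡⟨ sum-cong-≗ (λ i → trans (ι-* (toℕ (αs i)) (χ (Hs i) P))
                                                           (cong (ι (toℕ (αs i)) *_) (ι-χ (Hs i) P))) ⟩
    val (toℕ ∘ αs) (proj₁ ∘ Hs) (proj₁ P)             ∎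

  module _ {c : Word} (D : Decomp c) (c′ : Word) (c′∈C : InCode c′) (supp⊆ : ∀ P → Real c′ P → Real c P)
           (pm<q : p ℕ.* m[ c ] < q) where
    open Decomp D
    open Partitions D

    m = m[ c ]

    hyp : Fin m → V
    hyp = proj₁ ∘ H

    c-val : ∀ P → ι (toℕ (c P)) ≡ val (toℕ ∘ coef) hyp (proj₁ P)
    c-val P = trans (cong (ι ∘ toℕ) (sums P)) (ι-lincomb m H coef P)

    hole⇒hole : ∀ P → Hole c P → Hole c′ P
    hole⇒hole P hole = decidable-stable (toℕ (c′ P) ℕ.≟ 0) λ real → supp⊆ P real hole

    -- Off all hyperplanes of c the word c has a hole, hence so does c′, and `spanned-by-support`
    -- applies. Nonzero vectors are first normalized, as the support condition speaks only of
    -- points.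
    spanned : Σ (Fin m → ℕ) λ β → ∀ P → ι (toℕ (c′ P)) ≡ val β hyp (proj₁ P)
    spanned = let (k , Hs , αs , c′≡) = c′∈C
                  word≡ = λ P → trans (cong (ι ∘ toℕ) (c′≡ P)) (ι-lincomb k Hs αs P)
                  (β , eq) = spanned-by-support hyp (λ i → ≢0V-proper (hyp i) (normalized-≢0V (hyp i) (proj₂ (H i)))) pm<q
                               (toℕ ∘ αs) (proj₁ ∘ Hs) (supported (toℕ ∘ αs) (proj₁ ∘ Hs) word≡)
              in β , λ P → trans (word≡ P) (eq (proj₁ P) (normalized-≢0V (proj₁ P) (proj₂ P)))
      where
      supported : ∀ {K} (α : Fin K → ℕ) L → (∀ P → ι (toℕ (c′ P)) ≡ val α L (proj₁ P)) → Supported α L hyp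
      supported α L word≡ v v≢0 v∉ with normalize v v≢0
      ... | s , s≢0 , norm = begin
        val α L v             ≡⟨ val-scale s≢0 α L v ⟨
        val α L (scale s v)   ≡⟨ word≡ P ⟨
        ι (toℕ (c′ P))        ≡⟨ cong ι (hole⇒hole P hole) ⟩
        0#                    ∎
        where
        P = scale s v , norm
        hole : Hole c P
        hole = ι-≡0 prime (toℕ<n (c P)) (begin
          ι (toℕ (c P))                       ≡⟨ c-val P ⟩
          val (toℕ ∘ coef) hyp (scale s v)    ≡⟨ val-scale s≢0 (toℕ ∘ coef) hyp v ⟩
          val (toℕ ∘ coef) hyp v              ≡⟨ sum-zero (λ i → trans (cong (ι (toℕ (coef i)) *_) (𝟙-∉ {hyp i} {v} (v∉ i))) (zeroʳ _)) ⟩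
          0#                                  ∎)

    β = proj₁ spanned

    inverse : ∀ i → ∃ λ b → ι b * ι (toℕ (coef i)) ≡ 1#
    inverse i = ι-unit prime (toℕ<n (coef i)) (nonzero i)

    -- The ratio of the coefficients of c′ and c at `H i`.
    ρ : Fin m → Carrier
    ρ i = ι (β i) * ι (proj₁ (inverse i))

    ρ-coef : ∀ i → ρ i * ι (toℕ (coef i)) ≡ ι (β i)
    ρ-coef i = trans (*-assoc _ _ _) (trans (cong (ι (β i) *_) (proj₂ (inverse i))) (*-identityʳ _))

    term : Point → Fin m → Carrier
    term P k = ι (toℕ (coef k)) * 𝟙 (hyp k) (proj₁ P)

    c′-val : ∀ P → ι (toℕ (c′ P)) ≡ sum (λ k → ρ k * term P k)
    c′-val P = trans (proj₂ spanned P) (sum-cong-≗ λ k →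
      trans (cong (_* 𝟙 (hyp k) (proj₁ P)) (sym (ρ-coef k))) (*-assoc _ _ _))

    record IsEquiv (R : Rel) : Set where
      field
        R-refl  : ∀ i → T (R i i)
        R-sym   : ∀ i j → T (R i j) → T (R j i)
        R-trans : ∀ i j k → T (R i j) → T (R j k) → T (R i k)

    RatioConstant : Rel → Set
    RatioConstant R = ∀ i j → T (R i j) → ρ i ≡ ρ j

    module Step {R : Rel} (equiv : IsEquiv R) where
      open IsEquiv equiv
      open Classes R R-refl R-sym R-trans

      ι-restr : ∀ i P → ι (restr R i P) ≡ classSum (term P) i
      ι-restr i P = trans (ι-mod (sumFin m f)) (trans (ι-sumFin m f) (sum-cong-≗ pointwise))
        where
        f : Fin m → ℕ
        f j = if R j i then toℕ (coef j) ℕ.* χ (H j) P else 0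
        pointwise : ∀ j → ι (f j) ≡ (if R j i then term P j else 0#)
        pointwise j with R j i
        ... | true  = trans (ι-* (toℕ (coef j)) (χ (H j) P)) (cong (ι (toℕ (coef j)) *_) (ι-χ (H j) P))
        ... | false = refl

      -- At the hole P both Σₖ cₖ and Σₖ ρₖcₖ vanish, and only the parts of i and j contribute.
      adjacent-ratio : RatioConstant R → ∀ {i j} → Adjacent R i j → ρ i ≡ ρ j
      adjacent-ratio ρ-const {i} {j} (¬Rij , P , hole , restr-i≢0 , _ , others≡0) =
        x+-y≡0⇒x≡y (integral (trans (*-comm _ _) dᵢ≡0) classSum≢0)
        where
        -- After subtraction of ρ j the weights vanish on the part of j, so in the total only the
        -- part of i survives.
        d : Fin m → Carrier
        d k = ρ k + - ρ j
        d-const : ClassConstant d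
        d-const k l Rkl = cong (_+ - ρ j) (ρ-const k l Rkl)
        classSum≢0 : classSum (term P) i ≢ 0#
        classSum≢0 eq = ι-≢0 prime (toℕ<n _) restr-i≢0 (trans (ι-restr i P) eq)
        total : sum (λ k → d k * term P k) ≡ 0#
        total = begin
          sum (λ k → d k * term P k)                                  ≡⟨ sum-cong-≗ (λ k → distribʳ (term P k) (ρ k) (- ρ j)) ⟩
          sum (λ k → ρ k * term P k + - ρ j * term P k)               ≡⟨ ∑-distrib-+ (λ k → ρ k * term P k) (λ k → - ρ j * term P k) ⟩
          sum (λ k → ρ k * term P k) + sum (λ k → - ρ j * term P k)   ≡⟨ cong₂ _+_ (c′-val P) (*-distribˡ-sum (- ρ j) (term P)) ⟨
          ι (toℕ (c′ P)) + - ρ j * sum (term P)                       ≡⟨ cong₂ (λ s t → ι s + - ρ j * t) (hole⇒hole P hole)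
                                                                          (trans (sym (c-val P)) (cong ι hole)) ⟩
          0# + - ρ j * 0#                                             ≡⟨ trans (+-identityˡ _) (zeroʳ _) ⟩
          0#                                                          ∎
        -- Three cases: the part of i is erased, the weight is zero on the part of j, and any other
        -- part contributes zero at P by adjacency.
        others : ∀ l → erase i d l * classSum (term P) l ≡ 0#
        others l = by-part (T? (R l i)) (T? (R l j))
          where
          by-part : Dec (T (R l i)) → Dec (T (R l j)) → erase i d l * classSum (term P) l ≡ 0#
          by-part (yes Rli) _         = trans (cong (_* classSum (term P) l) (erase-∈ i d l Rli)) (zeroˡ _)
          by-part (no ¬Rli) (yes Rlj) = trans (cong (_* classSum (term P) l) (trans (erase-∉ i d l ¬Rli)
                                          (trans (cong (_+ - ρ j) (ρ-const l j Rlj)) (-‿inverseʳ (ρ j))))) (zeroˡ _)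
          by-part (no ¬Rli) (no ¬Rlj) = trans (cong (erase i d l *_) (trans (sym (ι-restr l P))
                                          (cong ι (others≡0 l ¬Rli ¬Rlj)))) (zeroʳ _)
        dᵢ≡0 : d i * classSum (term P) i ≡ 0#
        dᵢ≡0 = begin
          d i * classSum (term P) i                                             ≡⟨ +-identityʳ _ ⟨
          d i * classSum (term P) i + 0#                                        ≡⟨ cong (d i * classSum (term P) i +_)
            (sum-by-classes (term P) (allFin m) (erase i d) (erase-constant i d d-const) others (λ k → inj₁ (∈-allFin k))) ⟨
          d i * classSum (term P) i + sum (λ k → erase i d k * term P k)        ≡⟨ sum-erase (term P) i d d-const ⟨
          sum (λ k → d k * term P k)                                            ≡⟨ total ⟩
          0#                                                                    ∎

      connected-ratio : RatioConstant R → ∀ {i j} → Connected R i j → ρ i ≡ ρ j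
      connected-ratio ρ-const here               = refl
      connected-ratio ρ-const (inPart Rij conn)  = trans (ρ-const _ _ Rij) (connected-ratio ρ-const conn)
      connected-ratio ρ-const (viaEdge adj conn) = trans (adjacent-ratio ρ-const adj) (connected-ratio ρ-const conn)

      connected-trans : ∀ {i j k} → Connected R i j → Connected R j k → Connected R i k
      connected-trans here               conn′ = conn′
      connected-trans (inPart Rij conn)  conn′ = inPart Rij (connected-trans conn conn′)
      connected-trans (viaEdge adj conn) conn′ = viaEdge adj (connected-trans conn conn′)

      adjacent-sym : ∀ {i j} → Adjacent R i j → Adjacent R j i
      adjacent-sym (¬Rij , P , hole , i≢0 , j≢0 , others) =
        ¬Rij ∘ R-sym _ _ , P , hole , j≢0 , i≢0 , λ k ¬Rkj ¬Rki → others k ¬Rki ¬Rkj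

      connected-sym : ∀ {i j} → Connected R i j → Connected R j i
      connected-sym here               = here
      connected-sym (inPart Rij conn)  = connected-trans (connected-sym conn) (inPart (R-sym _ _ Rij) here)
      connected-sym (viaEdge adj conn) = connected-trans (connected-sym conn) (viaEdge (adjacent-sym adj) here)

      step-equiv : ∀ {R′} → IsStep R R′ → IsEquiv R′
      step-equiv step = record
        { R-refl  = λ i → from (step i i) here
        ; R-sym   = λ i j Rij → from (step j i) (connected-sym (to (step i j) Rij))
        ; R-trans = λ i j k Rij Rjk → from (step i k) (connected-trans (to (step i j) Rij) (to (step j k) Rjk))
        }
        where open Equivalence

      step-ratio : ∀ {R′} → IsStep R R′ → RatioConstant R → RatioConstant R′
      step-ratio step ρ-const i j Rij = connected-ratio ρ-const (Equivalence.to (step i j) Rij)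

    -- Both properties are carried through the induction together, because comparing ratios across
    -- an edge sums over the classes of the previous relation.
    stage-ratio : ∀ k R → Stage k R → IsEquiv R × RatioConstant R
    stage-ratio zero R stage = record
      { R-refl  = λ i → from (stage i i) refl
      ; R-sym   = λ i j Rij → from (stage j i) (sym (to (stage i j) Rij))
      ; R-trans = λ i j k Rij Rjk → from (stage i k) (trans (to (stage i j) Rij) (to (stage j k) Rjk))
      } , λ i j Rij → cong ρ (to (stage i j) Rij)
      where open Equivalence
    stage-ratio (suc k) R′ (R , stage , step) =
      let (equiv , ρ-const) = stage-ratio k R stage
      in Step.step-equiv equiv step , Step.step-ratio equiv step ρ-const

    multiple : InftyIsSingle → ∃ λ α → ∀ P → c′ P ≡ (toℕ {p} α ℕ.* toℕ (c P)) mod p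
    multiple (k , R , stage , _ , i₀ , single) = α , λ P → ι-toℕ-injective prime (begin
      ι (toℕ (c′ P))                                  ≡⟨ c′-val P ⟩
      sum (λ k → ρ k * term P k)                      ≡⟨ sum-cong-≗ (λ k → cong (_* term P k) (ρ≡ια k)) ⟩
      sum (λ k → ι (toℕ α) * term P k)                ≡⟨ *-distribˡ-sum (ι (toℕ α)) (term P) ⟨
      ι (toℕ α) * sum (term P)                        ≡⟨ cong (ι (toℕ α) *_) (c-val P) ⟨
      ι (toℕ α) * ι (toℕ (c P))                       ≡⟨ ι-* (toℕ α) (toℕ (c P)) ⟨
      ι (toℕ α ℕ.* toℕ (c P))                         ≡⟨ ι-mod (toℕ α ℕ.* toℕ (c P)) ⟨
      ι (toℕ ((toℕ α ℕ.* toℕ (c P)) mod p))           ∎)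
      where
      α : Fin p
      -- The ratio at i₀ is a natural multiple of 1, hence a residue modulo p; with a single part
      -- every other ratio equals it.
      α = (β i₀ ℕ.* proj₁ (inverse i₀)) mod p
      ρ≡ια : ∀ k → ρ k ≡ ι (toℕ α)
      ρ≡ια j = trans (proj₂ (stage-ratio k R stage) j i₀ (single j i₀))
        (sym (trans (ι-mod (β i₀ ℕ.* proj₁ (inverse i₀))) (ι-* (β i₀) (proj₁ (inverse i₀)))))

-- Characteristic, numerical bounds and the conclusion.

open import Data.Nat using (_*_; _^_)

-- The power p^h = q is zero in F, and a field has no zero divisors.
characteristic : ∀ {q p} (F : FiniteField q) h → q ≡ p ^ h → Field.ι F p ≡ FiniteField.0# F
characteristic {q} {p} F h q≡p^h = descend h (trans (cong ι (sym q≡p^h)) ιq≡0)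
  where
  open FiniteField F using (0#; 0≢1; _≟_)
  open Field F
  descend : ∀ h → ι (p ^ h) ≡ 0# → ι p ≡ 0#
  descend zero    eq = contradiction (trans (sym eq) (+-identityʳ _)) 0≢1
  descend (suc h) eq = decidable-stable (ι p ≟ 0#) λ ιp≢0 →
    ιp≢0 (descend h (integral (trans (sym (ι-* p (p ^ h))) eq) ιp≢0))

ceiling-≤ : ∀ {a b d} .{{_ : NonZero b}} → a ≤ d * b → ⌈ a / b ⌉ ≤ d
ceiling-≤ {a} {suc b} {d} a≤db = ℕₚ.≤-pred (m<n*o⇒m/o<n (begin-strict
  a ℕ.+ b             <⟨ ℕₚ.+-mono-≤-< a≤db (ℕₚ.n<1+n b) ⟩
  d * suc b ℕ.+ suc b ≡⟨ ℕₚ.+-comm (d * suc b) (suc b) ⟩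
  suc d * suc b       ∎))
  where open ℕₚ.≤-Reasoning

-- For h = 2, m < Δ ≤ p gives p m < p². For h > 2, m² < q and p² ≤ q give (p m)² < q² if p is
-- positive; comparing squares avoids the root in Δ.
few-hyperplanes : ∀ {p h q n Δ m} .{{_ : NonZero p}} → 2 ≤ h → q ≡ p ^ h → IsΔ n p h q Δ → m < Δ → p * m < q
few-hyperplanes {p} {h} {q} {n} {Δ} {m} 2≤h q≡p^h (large , square) m<Δ with ℕₚ.m≤n⇒m<n∨m≡n 2≤h
... | inj₂ refl = subst (p * m <_) (sym (trans q≡p^h (cong (p *_) (ℕₚ.*-identityʳ p))))
      (ℕₚ.*-monoʳ-< p (ℕₚ.<-≤-trans m<Δ (ℕₚ.≤-trans (ℕₚ.m≤m*n Δ (2 ^ n) {{ℕₚ.m^n≢0 2 n}}) (proj₁ (square refl)))))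
... | inj₁ 2<h = ℕₚ.≰⇒> λ q≤pm → ℕₚ.<-irrefl refl (begin-strict
  q * q             ≤⟨ ℕₚ.*-mono-≤ q≤pm q≤pm ⟩
  p * m * (p * m)   ≡⟨ ℕₚ.[m*n]*[o*p]≡[m*o]*[n*p] p m p m ⟩
  p * p * (m * m)   <⟨ ℕₚ.*-monoʳ-< (p * p) {{ℕₚ.m*n≢0 p p}} m²<q ⟩
  p * p * q         ≤⟨ ℕₚ.*-monoˡ-≤ q p²≤q ⟩
  q * q             ∎)
  where
  open ℕₚ.≤-Reasoning
  e = Δ * 2 ^ (n ∸ 2)
  m<e : m < e
  m<e = ℕₚ.<-≤-trans m<Δ (ℕₚ.m≤m*n Δ (2 ^ (n ∸ 2)) {{ℕₚ.m^n≢0 2 (n ∸ 2)}})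
  m²<q : m * m < q
  m²<q = ℕₚ.<-≤-trans (ℕₚ.*-mono-< m<e m<e) (subst (λ t → e * t ≤ q) (ℕₚ.*-identityʳ e) (proj₁ (large 2<h)))
  p²≤q : p * p ≤ q
  p²≤q = subst (p * p ≤_) (sym q≡p^h) (subst (λ t → p * t ≤ p ^ h) (ℕₚ.*-identityʳ p) (ℕₚ.^-monoʳ-≤ p 2≤h))

theorem3p7 : (p h q n : ℕ) .{{_ : NonZero p}} → Prime p → 2 ≤ h → q ≡ p ^ h → 27 < q → 2 ≤ n →
    (2 < h → (32 ≤ q) × (2 ^ (2 * n ∸ 4) ≤ q)) → (h ≡ 2 → 2 ^ (2 * n) ≤ q) →
    (F : FiniteField q) → (Δ : ℕ) → IsΔ n p h q Δ →
    (c : PG.Code.Word F n p) → PG.Code.InCode F n p c →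
    PG.Code.wt F n p c ≤ W n q Δ →
    (D : PG.Code.Decomp F n p c) → PG.Code.Partitions.InftyIsSingle F n p D →
    PG.Code.Minimal F n p c
theorem3p7 p h q n p-prime 2≤h q≡p^h _ _ _ _ F Δ isΔ c _ wt≤W D single@(_ , _ , _ , _ , i₀ , _) c′ c′∈C supp⊆ =
  Minimality.multiple F n p p-prime (characteristic F h q≡p^h) D c′ c′∈C supp⊆
    (few-hyperplanes {n = n} 2≤h q≡p^h isΔ (m<Δ Δ i₀ (ceiling-≤ {{θ-nonZero q (n ∸ 1)}} wt≤W))) single
  where
  -- For Δ = 0 the truncated Δ ∸ 1 is 0, so m = 0; the index i₀ from the single part excludes this.
  m<Δ : ∀ Δ {m} → Fin m → m ≤ Δ ∸ 1 → m < Δ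
  m<Δ zero    {suc m} _ ()
  m<Δ (suc Δ) _ m≤Δ = s≤s m≤Δ
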